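{- Let $n\ge3$, let $x\in S^n$ be $\frac12$-integer, and let $\mathcal{P}$ be any partition of the set of $\frac12$-edges of $x$ into pairs. Then $x$ is in the convex hull of incidence vectors of $1$-trees of $K_n$ that each contain exactly one edge from each pair in $\mathcal{P}$.
   Context: $K_n=(V_n,E_n)$ is the complete graph on $n$ nodes, one of which is labelled $1$. For $U\subseteq V_n$, $\delta(U)$ is the set of edges with exactly one endpoint in $U$, $x(F)=\sum_{e\in F}x_e$. $S^n=\{x\in\mathbb{R}^{E_n}: x(\delta(v))=2 \ \forall v,\ x(\delta(S))\ge 2\ \forall \emptyset\ne S\subsetneq V_n,\ 0\le x\le 1\}$. A point $x\in S^n$ is $\frac12$-integer if $x_e\in\{0,\frac12,1\}$ for all $e$; its $\frac12$-edges are the edges with $x_e=\frac12$. A $1$-tree is an edge set $F\subseteq E_n$ with $|F\cap\delta(1)|=2$ such that $F\setminus\delta(1)$ is a spanning tree on $V_n\setminus\{1\}$. -}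

module Defs where

open import Data.Nat using (ℕ)
open import Data.Fin using (Fin; _<?_; _≟_)
import Data.Fin as Fin
open import Data.Bool using (Bool; true; false; _∧_; _∨_; _xor_; not; if_then_else_)
open import Data.List using (List; []; _∷_; [_]; concatMap; map; foldr; allFin)
open import Data.List.Relation.Unary.All using (All)
open import Data.List.Relation.Binary.Permutation.Propositional using (_↭_)
open import Data.List.Membership.Propositional using (_∈_)
open import Data.Rational using (ℚ; 0ℚ; 1ℚ; ½; _+_; _*_; _≤_)
open import Data.Product using (Σ; ∃; _×_; _,_; proj₁; proj₂)
open import Data.Sum using (_⊎_)
open import Relation.Nullary using (¬_; yes; no)
open import Relation.Nullary.Decidable using (⌊_⌋)
open import Relation.Binary.PropositionalEquality using (_≡_; _≢_)

record Edge (n : ℕ) : Set where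
  constructor edge
  field
    lo  : Fin n
    hi  : Fin n
    lo<hi : lo Fin.< hi
open Edge public

edgeIf : ∀ {n} → Fin n → Fin n → List (Edge n)
edgeIf i j with i <? j
... | yes p = [ edge i j p ]
... | no _  = []

allEdges : (n : ℕ) → List (Edge n)
allEdges n = concatMap (λ i → concatMap (λ j → edgeIf i j) (allFin n)) (allFin n)

sumℚ : List ℚ → ℚ
sumℚ = foldr _+_ 0ℚ

2ℚ : ℚ
2ℚ = 1ℚ + 1ℚ

VSet : ℕ → Set
VSet n = Fin n → Bool

crosses : ∀ {n} → VSet n → Edge n → Bool
crosses S e = S (lo e) xor S (hi e)

single : ∀ {n} → Fin n → VSet n
single v w = ⌊ w ≟ v ⌋

incident : ∀ {n} → Fin n → Edge n → Bool
incident v = crosses (single v)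

cut : ∀ {n} → (Edge n → ℚ) → VSet n → ℚ
cut {n} x S = sumℚ (map (λ e → if crosses S e then x e else 0ℚ) (allEdges n))

InSubtour : (n : ℕ) → (Edge n → ℚ) → Set
InSubtour n x =
  (∀ (v : Fin n) → cut x (single v) ≡ 2ℚ) ×
  (∀ (S : VSet n) → (∃ λ v → S v ≡ true) → (∃ λ v → S v ≡ false) → 2ℚ ≤ cut x S) ×
  (∀ (e : Edge n) → 0ℚ ≤ x e × x e ≤ 1ℚ)

HalfInteger : ∀ {n} → (Edge n → ℚ) → Set
HalfInteger {n} x = ∀ (e : Edge n) → x e ≡ 0ℚ ⊎ x e ≡ ½ ⊎ x e ≡ 1ℚ

isHalf : ∀ {n} → (Edge n → ℚ) → Edge n → Bool
isHalf x e = ⌊ x e Data.Rational.≟ ½ ⌋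

filterB : ∀ {a} {A : Set a} → (A → Bool) → List A → List A
filterB p [] = []
filterB p (a ∷ as) = if p a then a ∷ filterB p as else filterB p as

halfEdges : ∀ {n} → (Edge n → ℚ) → List (Edge n)
halfEdges {n} x = filterB (isHalf x) (allEdges n)

flatten : ∀ {A : Set} → List (A × A) → List A
flatten [] = []
flatten ((a , b) ∷ ps) = a ∷ b ∷ flatten ps

-- P is a partition of the ½-edges of x into pairs: listing both members of
-- every pair gives exactly the ½-edges, each exactly once.
PairPartition : ∀ {n} → (Edge n → ℚ) → List (Edge n × Edge n) → Set
PairPartition x P = flatten P ↭ halfEdges x

ESet : ℕ → Set
ESet n = Edge n → Bool

data Reach {n : ℕ} (G : Edge n → Set) : Fin n → Fin n → Set where
  here : ∀ {u} → Reach G u u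
  fwd  : ∀ {v} (e : Edge n) → G e → Reach G (hi e) v → Reach G (lo e) v
  bwd  : ∀ {v} (e : Edge n) → G e → Reach G (lo e) v → Reach G (hi e) v

restrict : ∀ {n} → Fin n → ESet n → Edge n → Set
restrict r F e = F e ≡ true × incident r e ≡ false

-- G is a spanning tree on V_n ∖ {r}: it uses only edges of K_n - r, it is
-- connected on V_n ∖ {r}, and it is acyclic (no edge of G has its endpoints
-- joined by a path in G minus that edge).
SpanningTreeAvoiding : ∀ {n} → Fin n → (Edge n → Set) → Set
SpanningTreeAvoiding {n} r G =
  (∀ e → G e → incident r e ≡ false) ×
  (∀ (u v : Fin n) → u ≢ r → v ≢ r → Reach G u v) ×
  (∀ (e : Edge n) → G e → ¬ Reach (λ f → G f × f ≢ e) (lo e) (hi e))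

degIn : ∀ {n} → Fin n → ESet n → ℕ
degIn {n} r F = Data.List.length (filterB (λ e → F e ∧ incident r e) (allEdges n))

-- F is a 1-tree (vertex r playing the role of vertex 1)
OneTree : ∀ {n} → Fin n → ESet n → Set
OneTree r F = degIn r F ≡ 2 × SpanningTreeAvoiding r (restrict r F)

OnePerPair : ∀ {n} → List (Edge n × Edge n) → ESet n → Set
OnePerPair P F = ∀ {e f} → (e , f) ∈ P → (F e xor F f) ≡ true

χ : ∀ {n} → ESet n → Edge n → ℚ
χ F e = if F e then 1ℚ else 0ℚ

InConvexHull : ∀ {n} → (ESet n → Set) → (Edge n → ℚ) → Set
InConvexHull Good x =
  Σ (List (ℚ × ESet _)) λ L →
    All (λ p → 0ℚ ≤ proj₁ p × Good (proj₂ p)) L ×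
    sumℚ (map proj₁ L) ≡ 1ℚ ×
    (∀ e → sumℚ (map (λ p → proj₁ p * χ (proj₂ p) e) L) ≡ x e)

{-# OPTIONS --safe #-}

-- Deleting vertex r, the 1-tree polytope is cut out by y(E[S]) ≤ |S| - 1 for
-- nonempty S ∌ r (with equality for S = V ∖ r), y(δ(r)) = 2 and 0 ≤ y ≤ 1;
-- summing degrees over S shows that x satisfies these constraints.  Starting
-- from x, keep y_e + y_f = 1 for every pair {e , f} and repeatedly split a
-- non-integral point y into two points of the same polytope on a line through
-- y, with more tight constraints.  The direction of the line is an alternating
-- cycle.  By uncrossing, every fractional edge u has a fractional twin lying in
-- the same tight sets: in the smallest tight set D around u, remove the maximal
-- tight subsets missing u; the remaining edges have integral total weight, so u
-- is not the only fractional one.  Alternately passing from an edge to the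
-- other member of its pair and from there to a twin closes a cycle, along which
-- ±1 changes neither a pair sum nor a tight constraint.  The integral points
-- reached are 1-trees containing one edge of each pair.

module Submission where

open import Defs
open import Data.Nat using (ℕ; _≤_; zero; suc; z≤n; s≤s) renaming (_<_ to _<ℕ_)
import Data.Nat as Nat
import Data.Nat.Properties as ℕ
open import Data.Fin using (Fin)
import Data.Fin as Fin
import Data.Fin.Properties as Fin
open import Data.Bool using (Bool; true; false; not; _∧_; _∨_; _xor_; if_then_else_)
import Data.Bool.Properties as Bool
open import Data.List using (List; []; _∷_; _++_; map; length; filter; tabulate; concatMap; allFin)
open import Data.List.Relation.Unary.All as All using (All; []; _∷_)
import Data.List.Relation.Unary.All.Properties as Allₚ
open import Data.List.Relation.Unary.AllPairs using (AllPairs; []; _∷_)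
open import Data.List.Relation.Unary.Any as Any using (Any; here; there)
import Data.List.Relation.Unary.Any.Properties as Anyₚ
open import Data.List.Relation.Unary.Unique.Propositional using (Unique)
open import Data.List.Membership.Propositional using (_∈_; lose; find)
open import Data.List.Membership.Propositional.Properties
  using (∈-concatMap⁺; ∈-allFin; ∈-filter⁺; ∈-filter⁻; ∈-map⁺; ∈-++⁺ˡ; ∈-++⁺ʳ)
import Data.List.Relation.Binary.Permutation.Propositional as Perm
open Perm using (_↭_; ↭-sym)
open import Data.List.Relation.Binary.Permutation.Propositional.Properties using (∈-resp-↭)
open import Data.Product using (∃; _×_; _,_; proj₁; proj₂)
open import Data.Sum as Sum using (_⊎_; inj₁; inj₂)
open import Data.Unit using (⊤)
open import Data.Empty using (⊥; ⊥-elim)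
open import Data.Rational using (ℚ; 0ℚ; 1ℚ; ½; _+_; _*_; _-_; -_; 1/_)
  renaming (_≤_ to _≤ℚ_; _<_ to _<ℚ_)
import Data.Rational as ℚB
import Data.Rational.Properties as ℚ
open import Data.Rational.Solver using (module +-*-Solver)
open +-*-Solver using (solve; _:=_; _:+_; _:*_; :-_; _:-_; con)
open import Relation.Nullary using (¬_; Dec; yes; no)
open import Relation.Nullary.Decidable using (⌊_⌋; _×-dec_)
open import Relation.Binary.Definitions using (tri<; tri≈; tri>)
open import Relation.Binary.PropositionalEquality
  using (_≡_; _≢_; refl; sym; trans; cong; cong₂; subst; subst₂; module ≡-Reasoning)
open ≡-Reasoning

-- In matroid terms, 1-trees are the bases of the direct sum of the graphic matroid of K_n - r and
-- the uniform matroid of rank 2 on δ(r), while the pairs form a partition matroid; the splitting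
-- proves the integrality of a face of the intersection of the two. Half-integrality supplies the
-- starting point: x sums to ½ + ½ = 1 on each pair and is 0 or 1 on every other edge, so those
-- edges stay fixed. The pair equations hold along the whole line of movement and are carried as an
-- invariant; only the polytope inequalities can stop a movement. The delicate point is that the
-- alternating cycle has to give a nonzero direction: twins are not unique, pairs may be met again,
-- and signs could cancel. It is enough that the pair of one edge, the start, occurs only once on
-- the cycle. The direction is 1 there, and the bounds 0 and 1 on this edge stop the movement either
-- way.

-- Ordered arithmetic of the rationals

diff≥0 : ∀ {p q} → p ≤ℚ q → 0ℚ ≤ℚ q - p
diff≥0 {p} {q} p≤q = subst (_≤ℚ q - p) (ℚ.+-inverseʳ p) (ℚ.+-monoˡ-≤ (- p) p≤q)

-- Reduces an inequality to a ring identity: the gap `d` is written as a sum of terms known to be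
-- nonnegative and the solver does the rest.
≤-by : ∀ {p q d} → 0ℚ ≤ℚ d → p + d ≡ q → p ≤ℚ q
≤-by {p} {q} {d} 0≤d eq = subst₂ _≤ℚ_ (ℚ.+-identityʳ p) eq (ℚ.+-monoʳ-≤ p 0≤d)

+-≥0 : ∀ {p q} → 0ℚ ≤ℚ p → 0ℚ ≤ℚ q → 0ℚ ≤ℚ p + q
+-≥0 = ℚ.+-mono-≤

*-≥0 : ∀ {p q} → 0ℚ ≤ℚ p → 0ℚ ≤ℚ q → 0ℚ ≤ℚ p * q
*-≥0 {p} {q} 0≤p 0≤q =
  subst (_≤ℚ p * q) (ℚ.*-zeroʳ p) (ℚ.*-monoˡ-≤-nonNeg p {{ℚB.nonNegative 0≤p}} 0≤q)

≢0⇒>0 : ∀ {p} → 0ℚ ≤ℚ p → p ≢ 0ℚ → 0ℚ <ℚ p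
≢0⇒>0 {p} 0≤p p≢0 with ℚ.<-cmp 0ℚ p
... | tri< 0<p _ _ = 0<p
... | tri≈ _ 0≡p _ = ⊥-elim (p≢0 (sym 0≡p))
... | tri> _ _ p<0 = ⊥-elim (ℚ.<-irrefl refl (ℚ.<-≤-trans p<0 0≤p))

*->0 : ∀ {p q} → 0ℚ <ℚ p → 0ℚ <ℚ q → 0ℚ <ℚ p * q
*->0 {p} {q} 0<p 0<q =
  ℚ.positive⁻¹ (p * q) {{ℚ.pos*pos⇒pos p {{ℚB.positive 0<p}} q {{ℚB.positive 0<q}}}}

positive-inverse : ∀ {u} → 0ℚ <ℚ u → ∃ λ v → 0ℚ <ℚ v × v * u ≡ 1ℚ
positive-inverse {u} 0<u = 1/ u , ℚ.positive⁻¹ (1/ u) {{ℚ.1/pos⇒pos u}} , ℚ.*-inverseˡ u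
  where
  instance
    pos : ℚB.Positive u
    pos = ℚB.positive 0<u
    nonZero : ℚB.NonZero u
    nonZero = ℚ.pos⇒nonZero u

cancel-inverse : ∀ s v t → v * (- t) ≡ 1ℚ → s + s * v * t ≡ 0ℚ
cancel-inverse s v t eq = begin
  s + s * v * t        ≡⟨ solve 3 (λ s v t → s :+ s :* v :* t := s :- s :* (v :* (:- t))) refl s v t ⟩
  s - s * (v * (- t))  ≡⟨ cong (λ z → s - s * z) eq ⟩
  s - s * 1ℚ           ≡⟨ solve 1 (λ s → s :- s :* con 1ℚ := con 0ℚ) refl s ⟩
  0ℚ                   ∎

0≤1 : 0ℚ ≤ℚ 1ℚ
0≤1 = ℚ.<⇒≤ (ℚ.positive⁻¹ 1ℚ)

-- Indicators, finite sums and counting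

ind : Bool → ℚ
ind true  = 1ℚ
ind false = 0ℚ

ind≥0 : ∀ b → 0ℚ ≤ℚ ind b
ind≥0 true  = 0≤1
ind≥0 false = ℚ.≤-refl

sum : ∀ {A : Set} → List A → (A → ℚ) → ℚ
sum as f = sumℚ (map f as)

module _ {A : Set} where

  sum-cong : ∀ (as : List A) {f g} → (∀ a → f a ≡ g a) → sum as f ≡ sum as g
  sum-cong []       eq = refl
  sum-cong (a ∷ as) eq = cong₂ _+_ (eq a) (sum-cong as eq)

  sum-0 : ∀ (as : List A) → sum as (λ _ → 0ℚ) ≡ 0ℚ
  sum-0 []       = refl
  sum-0 (a ∷ as) = trans (ℚ.+-identityˡ _) (sum-0 as)

  sum-+ : ∀ (as : List A) f g → sum as (λ a → f a + g a) ≡ sum as f + sum as g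
  sum-+ []       f g = refl
  sum-+ (a ∷ as) f g = trans (cong (f a + g a +_) (sum-+ as f g))
    (solve 4 (λ p q r s → p :+ q :+ (r :+ s) := p :+ r :+ (q :+ s)) refl (f a) (g a) _ _)

  sum-* : ∀ (as : List A) k f → sum as (λ a → k * f a) ≡ k * sum as f
  sum-* []       k f = sym (ℚ.*-zeroʳ k)
  sum-* (a ∷ as) k f = trans (cong (k * f a +_) (sum-* as k f)) (sym (ℚ.*-distribˡ-+ k _ _))

  sum-++ : ∀ (as bs : List A) f → sum (as ++ bs) f ≡ sum as f + sum bs f
  sum-++ []       bs f = sym (ℚ.+-identityˡ _)
  sum-++ (a ∷ as) bs f = trans (cong (f a +_) (sum-++ as bs f)) (sym (ℚ.+-assoc (f a) _ _))

  sum≥0 : ∀ (as : List A) {f} → (∀ a → 0ℚ ≤ℚ f a) → 0ℚ ≤ℚ sum as f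
  sum≥0 []       f≥0 = ℚ.≤-refl
  sum≥0 (a ∷ as) f≥0 = +-≥0 (f≥0 a) (sum≥0 as f≥0)

  term≤sum : ∀ {as : List A} {f a} → (∀ b → 0ℚ ≤ℚ f b) → a ∈ as → f a ≤ℚ sum as f
  term≤sum {a ∷ as} f≥0 (here refl) = ≤-by (sum≥0 as f≥0) refl
  term≤sum {b ∷ as} {f} f≥0 (there a∈as) = ℚ.≤-trans (term≤sum f≥0 a∈as) (≤-by (f≥0 b) (ℚ.+-comm _ (f b)))

sum-swap : ∀ {A B : Set} (as : List A) (bs : List B) (f : A → B → ℚ) →
           sum as (λ a → sum bs (f a)) ≡ sum bs (λ b → sum as (λ a → f a b))
sum-swap []       bs f = sym (sum-0 bs)
sum-swap (a ∷ as) bs f = trans (cong (sum bs (f a) +_) (sum-swap as bs f)) (sym (sum-+ bs (f a) _))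

filterB-length-≤ : ∀ {C : Set} (p q : C → Bool) {L : List C} →
  All (λ c → p c ≡ false → q c ≡ false) L →
  length (filterB q L) ≤ length (filterB p L)
filterB-length-≤ p q [] = z≤n
filterB-length-≤ p q {c ∷ L} (h ∷ hs) with p c | q c
... | true  | true  = s≤s (filterB-length-≤ p q hs)
... | true  | false = ℕ.m≤n⇒m≤1+n (filterB-length-≤ p q hs)
... | false | false = filterB-length-≤ p q hs
... | false | true  with h refl
... | ()

-- Behind every termination measure below: loose constraints, edges not yet on a path, vertices not
-- yet reached.
filterB-length-< : ∀ {C : Set} (p q : C → Bool) {L : List C} →
  All (λ c → p c ≡ false → q c ≡ false) L → Any (λ c → p c ≡ true × q c ≡ false) L →
  length (filterB q L) <ℕ length (filterB p L)
filterB-length-< p q {c ∷ L} (h ∷ hs) (here (pc , qc)) rewrite pc | qc = s≤s (filterB-length-≤ p q hs)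
filterB-length-< p q {c ∷ L} (h ∷ hs) (there t) with p c | q c
... | true  | true  = s≤s (filterB-length-< p q hs t)
... | true  | false = ℕ.m≤n⇒m≤1+n (filterB-length-< p q hs t)
... | false | false = filterB-length-< p q hs t
... | false | true  with h refl
... | ()

-- Ratio test: s is the vector of slacks of the constraints, t their rates of
-- change along a direction.
module _ {C : Set} (s t : C → ℚ) where

  Along : ℚ → C → ℚ
  Along α c = s c + α * t c

  Blocks : ℚ → C → Set
  Blocks α c = s c ≢ 0ℚ × Along α c ≡ 0ℚ

  along≥0 : ∀ {α c} → 0ℚ ≤ℚ α → 0ℚ ≤ℚ s c → 0ℚ ≤ℚ t c → 0ℚ ≤ℚ Along α c
  along≥0 0≤α 0≤s 0≤t = +-≥0 0≤s (*-≥0 0≤α 0≤t)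

  -- A slack is affine in the step length: with a rising rate it is compared with its value at 0,
  -- with a falling one with its value at `β`.
  along-mono : ∀ {α β c} → 0ℚ ≤ℚ α → α ≤ℚ β → 0ℚ ≤ℚ s c → 0ℚ ≤ℚ Along β c → 0ℚ ≤ℚ Along α c
  along-mono {α} {β} {c} 0≤α α≤β 0≤s 0≤β with ℚ.≤-total 0ℚ (t c)
  ... | inj₁ 0≤t = along≥0 {c = c} 0≤α 0≤s 0≤t
  ... | inj₂ t≤0 = ℚ.≤-trans 0≤β (≤-by (*-≥0 (diff≥0 α≤β) (diff≥0 t≤0))
    (solve 4 (λ s t a b → s :+ b :* t :+ (b :- a) :* (con 0ℚ :- t) := s :+ a :* t) refl (s c) (t c) α β))

  -- The slack vanishes at s / (-t). This is positive because a constraint that is already tight has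
  -- rate 0 and so cannot fall.
  blocking-step : ∀ c → 0ℚ ≤ℚ s c → (s c ≡ 0ℚ → t c ≡ 0ℚ) → t c <ℚ 0ℚ →
                  ∃ λ α → 0ℚ <ℚ α × Blocks α c
  blocking-step c 0≤s s→t t<0 = s c * 1/u , 0<α , s≢0 , eq
    where
    0<u : 0ℚ <ℚ - t c
    0<u = ℚ.neg-antimono-< t<0
    inv = positive-inverse 0<u
    1/u : ℚ
    1/u = proj₁ inv
    s≢0 : s c ≢ 0ℚ
    s≢0 s≡0 = ℚ.<-irrefl (s→t s≡0) t<0
    0<α : 0ℚ <ℚ s c * 1/u
    0<α = *->0 (≢0⇒>0 0≤s s≢0) (proj₁ (proj₂ inv))
    eq : s c + s c * 1/u * t c ≡ 0ℚ
    eq = cancel-inverse (s c) 1/u (t c) (proj₂ (proj₂ inv))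

  Ratio : List C → Set
  Ratio L = ∃ λ α → 0ℚ <ℚ α × All (λ c → 0ℚ ≤ℚ Along α c) L × Any (Blocks α) L

  all-along≥0 : ∀ {L α} → 0ℚ <ℚ α → All (λ c → 0ℚ ≤ℚ s c) L → All (λ c → 0ℚ ≤ℚ t c) L →
                All (λ c → 0ℚ ≤ℚ Along α c) L
  all-along≥0 0<α []       []       = []
  all-along≥0 0<α (p ∷ ps) (q ∷ qs) = along≥0 (ℚ.<⇒≤ 0<α) p q ∷ all-along≥0 0<α ps qs

  all-along-mono : ∀ {L α β} → 0ℚ <ℚ α → α ≤ℚ β → All (λ c → 0ℚ ≤ℚ s c) L →
                   All (λ c → 0ℚ ≤ℚ Along β c) L → All (λ c → 0ℚ ≤ℚ Along α c) L
  all-along-mono 0<α α≤β []       []       = []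
  all-along-mono 0<α α≤β (p ∷ ps) (q ∷ qs) =
    along-mono (ℚ.<⇒≤ 0<α) α≤β p q ∷ all-along-mono 0<α α≤β ps qs

  ratio-keep : ∀ {c L} → 0ℚ ≤ℚ s c → 0ℚ ≤ℚ t c → Ratio L → Ratio (c ∷ L)
  ratio-keep 0≤s 0≤t (α , 0<α , ok , bl) = α , 0<α , along≥0 (ℚ.<⇒≤ 0<α) 0≤s 0≤t ∷ ok , there bl

  ratio-first : ∀ {c L} → All (λ c → 0ℚ ≤ℚ s c) L → All (λ c → 0ℚ ≤ℚ t c) L →
                (∃ λ α → 0ℚ <ℚ α × Blocks α c) → Ratio (c ∷ L)
  ratio-first hs ok (α , 0<α , b) =
    α , 0<α , ℚ.≤-reflexive (sym (proj₂ b)) ∷ all-along≥0 0<α hs ok , here b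

  ratio-min : ∀ {c L} → 0ℚ ≤ℚ s c → All (λ c → 0ℚ ≤ℚ s c) L →
              (∃ λ α → 0ℚ <ℚ α × Blocks α c) → Ratio L → Ratio (c ∷ L)
  ratio-min 0≤s hs (α , 0<α , b) (β , 0<β , ok , bl) with ℚ.≤-total α β
  ... | inj₁ α≤β =
    α , 0<α , ℚ.≤-reflexive (sym (proj₂ b)) ∷ all-along-mono 0<α α≤β hs ok , here b
  ... | inj₂ β≤α =
    β , 0<β , along-mono (ℚ.<⇒≤ 0<β) β≤α 0≤s (ℚ.≤-reflexive (sym (proj₂ b))) ∷ ok , there bl

  -- The minimum ranges over the falling constraints only. The first alternative records that none
  -- has occurred yet, which the induction along the list has to allow.
  ratio-test′ : ∀ {L} → All (λ c → 0ℚ ≤ℚ s c) L → All (λ c → s c ≡ 0ℚ → t c ≡ 0ℚ) L →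
    All (λ c → 0ℚ ≤ℚ t c) L ⊎ Ratio L
  ratio-test′ [] [] = inj₁ []
  ratio-test′ {c ∷ L} (0≤s ∷ hs) (s→t ∷ ts) with 0ℚ ℚ.≤? t c
  ... | yes 0≤t = Sum.map (0≤t ∷_) (ratio-keep 0≤s 0≤t) (ratio-test′ hs ts)
  ... | no 0≰t  = inj₂ (Sum.[ (λ ok → ratio-first hs ok block) , ratio-min 0≤s hs block ]′ (ratio-test′ hs ts))
    where block = blocking-step c 0≤s s→t (ℚ.≰⇒> 0≰t)

  ratio-test : ∀ {L} → All (λ c → 0ℚ ≤ℚ s c) L → All (λ c → s c ≡ 0ℚ → t c ≡ 0ℚ) L →
    Any (λ c → t c <ℚ 0ℚ) L →
    Ratio L
  ratio-test hs ts neg with ratio-test′ hs ts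
  ... | inj₂ r  = r
  ... | inj₁ ok = ⊥-elim (All.lookupWith (λ 0≤t t<0 → ℚ.<-irrefl refl (ℚ.<-≤-trans t<0 0≤t)) ok neg)

-- Linear programming

-- Binary mixing mirrors the splitting of a point into two. The pointwise equation in `mix` stands
-- in for equality of functions.
data Hull {A : Set} (G : (A → ℚ) → Set) : (A → ℚ) → Set where
  point : ∀ {y} → G y → Hull G y
  mix   : ∀ {y z w} k l → 0ℚ ≤ℚ k → 0ℚ ≤ℚ l → k + l ≡ 1ℚ → Hull G y → Hull G z →
          (∀ a → k * y a + l * z a ≡ w a) → Hull G w

module _ {A : Set} (as : List A) where

  dot : (A → ℚ) → (A → ℚ) → ℚ
  dot a y = sum as (λ e → a e * y e)

  dot-congˡ : ∀ {a b} y → (∀ e → a e ≡ b e) → dot a y ≡ dot b y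
  dot-congˡ y eq = sum-cong as (λ e → cong (_* y e) (eq e))

  dot-congʳ : ∀ a {y z} → (∀ e → y e ≡ z e) → dot a y ≡ dot a z
  dot-congʳ a eq = sum-cong as (λ e → cong (a e *_) (eq e))

  dot-+ˡ : ∀ a b y → dot (λ e → a e + b e) y ≡ dot a y + dot b y
  dot-+ˡ a b y = trans (sum-cong as (λ e → ℚ.*-distribʳ-+ (y e) (a e) (b e))) (sum-+ as _ _)

  dot-*ˡ : ∀ k a y → dot (λ e → k * a e) y ≡ k * dot a y
  dot-*ˡ k a y = trans (sum-cong as (λ e → ℚ.*-assoc k (a e) (y e))) (sum-* as k _)

  dot-+ʳ : ∀ a y z → dot a (λ e → y e + z e) ≡ dot a y + dot a z
  dot-+ʳ a y z = trans (sum-cong as (λ e → ℚ.*-distribˡ-+ (a e) (y e) (z e))) (sum-+ as _ _)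

  dot-*ʳ : ∀ a k y → dot a (λ e → k * y e) ≡ k * dot a y
  dot-*ʳ a k y = trans
    (sum-cong as (λ e → solve 3 (λ a k y → a :* (k :* y) := k :* (a :* y)) refl (a e) k (y e)))
    (sum-* as k _)

  dot-≥0 : ∀ {a y} → (∀ e → 0ℚ ≤ℚ a e) → (∀ e → 0ℚ ≤ℚ y e) → 0ℚ ≤ℚ dot a y
  dot-≥0 a≥0 y≥0 = sum≥0 as (λ e → *-≥0 (a≥0 e) (y≥0 e))

-- With v = 1 / (p + q), the ends of the segment get weights inversely proportional to their
-- distances `p` and `q` from `y`.
average-of-steps : ∀ p q v y d → v * (p + q) ≡ 1ℚ →
          q * v * (y + p * d) + p * v * (y + q * (- 1ℚ * d)) ≡ y
average-of-steps p q v y d eq = begin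
  q * v * (y + p * d) + p * v * (y + q * (- 1ℚ * d))
    ≡⟨ solve 5 (λ p q v y d → q :* v :* (y :+ p :* d) :+ p :* v :* (y :+ q :* (con (- 1ℚ) :* d))
                  := v :* (p :+ q) :* y) refl p q v y d ⟩
  v * (p + q) * y  ≡⟨ cong (_* y) eq ⟩
  1ℚ * y           ≡⟨ ℚ.*-identityˡ y ⟩
  y                ∎

-- (a , b) stands for the inequality a · y ≤ b.
Constraint : Set → Set
Constraint A = (A → ℚ) × ℚ

module _ {A : Set} (as : List A) where

  slack : (A → ℚ) → Constraint A → ℚ
  slack y (a , b) = b - dot as a y

  rate : (A → ℚ) → Constraint A → ℚ
  rate d (a , _) = - dot as a d

  move : (A → ℚ) → ℚ → (A → ℚ) → A → ℚ
  move y k d e = y e + k * d e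

  slack-move : ∀ y k d c → slack (move y k d) c ≡ slack y c + k * rate d c
  slack-move y k d (a , b) = begin
    b - dot as a (move y k d)
      ≡⟨ cong (λ z → b - z) (trans (dot-+ʳ as a y _) (cong (dot as a y +_) (dot-*ʳ as a k d))) ⟩
    b - (dot as a y + k * dot as a d)
      ≡⟨ solve 4 (λ b p k q → b :- (p :+ k :* q) := b :- p :+ k :* (:- q)) refl b _ k _ ⟩
    b - dot as a y + k * - dot as a d ∎

  module _ (C : List (Constraint A)) where

    Feasible : (A → ℚ) → Set
    Feasible y = All (λ c → 0ℚ ≤ℚ slack y c) C

    Tight : (A → ℚ) → Constraint A → Set
    Tight y c = slack y c ≡ 0ℚ

    loose : (A → ℚ) → Constraint A → Bool
    loose y c = not ⌊ slack y c ℚ.≟ 0ℚ ⌋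

    tight⇒¬loose : ∀ y c → Tight y c → loose y c ≡ false
    tight⇒¬loose y c eq with slack y c ℚ.≟ 0ℚ
    ... | yes _ = refl
    ... | no ¬eq = ⊥-elim (¬eq eq)

    ¬loose⇒tight : ∀ y c → loose y c ≡ false → Tight y c
    ¬loose⇒tight y c h with slack y c ℚ.≟ 0ℚ
    ... | yes eq = eq

    loose-true : ∀ y c → slack y c ≢ 0ℚ → loose y c ≡ true
    loose-true y c ¬eq with slack y c ℚ.≟ 0ℚ
    ... | yes eq = ⊥-elim (¬eq eq)
    ... | no _   = refl

    -- `falls` stops the movement forwards and `rises` backwards, so a longest step exists both
    -- ways. The invariant is asked for every `k`, so negative ones serve the backward step.
    record Direction (Inv : (A → ℚ) → Set) (y : A → ℚ) : Set where
      field
        dir       : A → ℚ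
        keeps     : All (λ c → Tight y c → rate dir c ≡ 0ℚ) C
        invariant : ∀ k → Inv (move y k dir)
        falls     : Any (λ c → rate dir c <ℚ 0ℚ) C
        rises     : Any (λ c → 0ℚ <ℚ rate dir c) C
    open Direction

    #loose : (A → ℚ) → ℕ
    #loose y = length (filterB (loose y) C)

    record Step (y d : A → ℚ) : Set where
      field
        size     : ℚ
        size>0   : 0ℚ <ℚ size
        feasible : Feasible (move y size d)
        fewer    : #loose (move y size d) <ℕ #loose y
    open Step

    -- Tight constraints have rate 0 and stay tight, and the blocking constraint becomes tight, so
    -- the number of loose ones drops strictly.
    longest-step : ∀ {y} d → Feasible y → All (λ c → Tight y c → rate d c ≡ 0ℚ) C →
                   Any (λ c → rate d c <ℚ 0ℚ) C → Step y d
    longest-step {y} d feas keep fall = step (ratio-test (slack y) (rate d) feas keep fall)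
      where
      stays : ∀ k c → Tight y c → (Tight y c → rate d c ≡ 0ℚ) → Tight (move y k d) c
      stays k c tight t≡0 = begin
        slack (move y k d) c      ≡⟨ slack-move y k d c ⟩
        slack y c + k * rate d c  ≡⟨ cong₂ (λ p q → p + k * q) tight (t≡0 tight) ⟩
        0ℚ + k * 0ℚ               ≡⟨ solve 1 (λ k → con 0ℚ :+ k :* con 0ℚ := con 0ℚ) refl k ⟩
        0ℚ                        ∎
      step : Ratio (slack y) (rate d) C → Step y d
      step (k , 0<k , ok , block) = record
        { size = k
        ; size>0 = 0<k
        ; feasible = All.map (λ {c} p → subst (0ℚ ≤ℚ_) (sym (slack-move y k d c)) p) ok
        ; fewer = filterB-length-< (loose y) (loose (move y k d))
            (All.map (λ {c} t≡0 ¬l → tight⇒¬loose (move y k d) c (stays k c (¬loose⇒tight y c ¬l) t≡0)) keep)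
            (Any.map (λ {c} b → loose-true y c (proj₁ b) ,
                                tight⇒¬loose (move y k d) c (trans (slack-move y k d c) (proj₂ b))) block)
        }

    neg : (A → ℚ) → A → ℚ
    neg d e = - 1ℚ * d e

    rate-neg : ∀ d c → rate (neg d) c ≡ - rate d c
    rate-neg d (a , b) = cong -_ (trans (dot-*ʳ as a (- 1ℚ) d)
      (solve 1 (λ p → con (- 1ℚ) :* p := :- p) refl (dot as a d)))

    move-neg : ∀ y k d e → move y k (neg d) e ≡ move y (- k) d e
    move-neg y k d e = solve 3 (λ y k d → y :+ k :* (con (- 1ℚ) :* d) := y :+ (:- k) :* d) refl (y e) k (d e)

    convex : ∀ {y d} (s : Step y d) (s′ : Step y (neg d)) {G} →
             Hull G (move y (size s) d) → Hull G (move y (size s′) (neg d)) → Hull G y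
    convex {y} {d} s s′ {G} h h′ = average (positive-inverse (ℚ.+-mono-< (size>0 s) (size>0 s′)))
      where
      p q : ℚ
      p = size s
      q = size s′
      average : (∃ λ v → 0ℚ <ℚ v × v * (p + q) ≡ 1ℚ) → Hull G y
      average (v , 0<v , eq) = mix (q * v) (p * v)
        (*-≥0 (ℚ.<⇒≤ (size>0 s′)) (ℚ.<⇒≤ 0<v)) (*-≥0 (ℚ.<⇒≤ (size>0 s)) (ℚ.<⇒≤ 0<v))
        (trans (solve 3 (λ p q v → q :* v :+ p :* v := v :* (p :+ q)) refl p q v) eq)
        h h′ (λ e → average-of-steps p q v (y e) (d e) eq)

    -- A feasible point lies between the two points at which a line through it
    -- first meets further constraints, and these have fewer loose constraints.
    feasible⇒hull : ∀ {Inv G : (A → ℚ) → Set} →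
      (∀ {y z} → (∀ e → y e ≡ z e) → Inv y → Inv z) →
      (∀ {y} → Feasible y → Inv y → G y ⊎ Direction Inv y) →
      ∀ k {y} → #loose y ≤ k → Feasible y → Inv y → Hull G y
    feasible⇒hull {Inv} {G} resp choose = hull
      where
      descend : ∀ k {y} → #loose y ≤ k → Feasible y → G y ⊎ Direction Inv y → Hull G y
      hull : ∀ k {y} → #loose y ≤ k → Feasible y → Inv y → Hull G y
      hull k bound feas inv = descend k bound feas (choose feas inv)
      descend k bound feas (inj₁ good) = point good
      -- No constraint is loose here, yet a step would have to leave even fewer loose.
      descend zero {y} bound feas (inj₂ D) =
        ⊥-elim (ℕ.n≮0 (ℕ.≤-trans (fewer (longest-step (dir D) feas (keeps D) (falls D))) bound))
      descend (suc k) {y} bound feas (inj₂ D) = convex s s′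
        (hull k (ℕ.≤-pred (ℕ.≤-trans (fewer s) bound)) (feasible s) (invariant D (size s)))
        (hull k (ℕ.≤-pred (ℕ.≤-trans (fewer s′) bound)) (feasible s′)
          -- Moving along the negated direction and moving by a negative amount agree only
          -- pointwise, hence the transport of the invariant.
          (resp (λ e → sym (move-neg y (size s′) d e)) (invariant D (- size s′))))
        where
        d = dir D
        s : Step y d
        s = longest-step d feas (keeps D) (falls D)
        s′ : Step y (neg d)
        s′ = longest-step (neg d) feas
          (All.map (λ {c} t tight → trans (rate-neg d c) (cong -_ (t tight))) (keeps D))
          (Any.map (λ {c} p → subst (_<ℚ 0ℚ) (sym (rate-neg d c)) (ℚ.neg-antimono-< p)) (rises D))

-- From binary mixtures to weighted lists of edge sets

module _ {n : ℕ} {Good : ESet n → Set} where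

  scale : ℚ → List (ℚ × ESet n) → List (ℚ × ESet n)
  scale k = map (λ p → k * proj₁ p , proj₂ p)

  weight : List (ℚ × ESet n) → ℚ
  weight L = sum L proj₁

  barycentre : List (ℚ × ESet n) → Edge n → ℚ
  barycentre L e = sum L (λ p → proj₁ p * χ (proj₂ p) e)

  weight-scale : ∀ k L → weight (scale k L) ≡ k * weight L
  weight-scale k []      = sym (ℚ.*-zeroʳ k)
  weight-scale k (p ∷ L) = trans (cong (k * proj₁ p +_) (weight-scale k L)) (sym (ℚ.*-distribˡ-+ k _ _))

  barycentre-scale : ∀ k L e → barycentre (scale k L) e ≡ k * barycentre L e
  barycentre-scale k []      e = sym (ℚ.*-zeroʳ k)
  barycentre-scale k (p ∷ L) e = trans
    (cong₂ _+_ (ℚ.*-assoc k (proj₁ p) _) (barycentre-scale k L e)) (sym (ℚ.*-distribˡ-+ k _ _))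

  scale-good : ∀ {k} → 0ℚ ≤ℚ k → ∀ {L} → All (λ p → 0ℚ ≤ℚ proj₁ p × Good (proj₂ p)) L →
               All (λ p → 0ℚ ≤ℚ proj₁ p × Good (proj₂ p)) (scale k L)
  scale-good 0≤k []             = []
  scale-good 0≤k ((h , g) ∷ hs) = (*-≥0 0≤k h , g) ∷ scale-good 0≤k hs

  pointHull : ∀ {y F} → Good F → (∀ e → χ F e ≡ y e) → InConvexHull Good y
  pointHull {y} {F} good eq = (1ℚ , F) ∷ [] , (0≤1 , good) ∷ [] , refl , λ e →
    trans (solve 1 (λ p → con 1ℚ :* p :+ con 0ℚ := p) refl (χ F e)) (eq e)

  mixHull : ∀ {y z w} k l → 0ℚ ≤ℚ k → 0ℚ ≤ℚ l → k + l ≡ 1ℚ →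
            InConvexHull Good y → InConvexHull Good z → (∀ e → k * y e + l * z e ≡ w e) →
            InConvexHull Good w
  mixHull {y} {z} {w} k l 0≤k 0≤l k+l (L , goodL , wL , bL) (M , goodM , wM , bM) eq =
    scale k L ++ scale l M , Allₚ.++⁺ (scale-good 0≤k goodL) (scale-good 0≤l goodM) , weights , centres
    where
    weights : weight (scale k L ++ scale l M) ≡ 1ℚ
    weights = begin
      weight (scale k L ++ scale l M)          ≡⟨ sum-++ (scale k L) (scale l M) proj₁ ⟩
      weight (scale k L) + weight (scale l M)  ≡⟨ cong₂ _+_ (weight-scale k L) (weight-scale l M) ⟩
      k * weight L + l * weight M              ≡⟨ cong₂ (λ p q → k * p + l * q) wL wM ⟩
      k * 1ℚ + l * 1ℚ                          ≡⟨ cong₂ _+_ (ℚ.*-identityʳ k) (ℚ.*-identityʳ l) ⟩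
      k + l                                    ≡⟨ k+l ⟩
      1ℚ                                       ∎
    centres : ∀ e → barycentre (scale k L ++ scale l M) e ≡ w e
    centres e = begin
      barycentre (scale k L ++ scale l M) e
        ≡⟨ sum-++ (scale k L) (scale l M) _ ⟩
      barycentre (scale k L) e + barycentre (scale l M) e
        ≡⟨ cong₂ _+_ (barycentre-scale k L e) (barycentre-scale l M e) ⟩
      k * barycentre L e + l * barycentre M e
        ≡⟨ cong₂ (λ p q → k * p + l * q) (bL e) (bM e) ⟩
      k * y e + l * z e
        ≡⟨ eq e ⟩
      w e ∎

  hull⇒convexHull : ∀ {G : (Edge n → ℚ) → Set} →
    (∀ {y} → G y → ∃ λ F → Good F × (∀ e → χ F e ≡ y e)) →
    ∀ {y} → Hull G y → InConvexHull Good y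
  hull⇒convexHull round (point g) = pointHull (proj₁ (proj₂ (round g))) (proj₂ (proj₂ (round g)))
  hull⇒convexHull round (mix k l 0≤k 0≤l k+l hy hz eq) =
    mixHull k l 0≤k 0≤l k+l (hull⇒convexHull round hy) (hull⇒convexHull round hz) eq

-- Integrality

nat : ℕ → ℚ
nat zero    = 0ℚ
nat (suc k) = 1ℚ + nat k

nat-+ : ∀ a b → nat (a Nat.+ b) ≡ nat a + nat b
nat-+ zero    b = sym (ℚ.+-identityˡ (nat b))
nat-+ (suc a) b = trans (cong (1ℚ +_) (nat-+ a b)) (sym (ℚ.+-assoc 1ℚ (nat a) (nat b)))

nat≥0 : ∀ k → 0ℚ ≤ℚ nat k
nat≥0 zero    = ℚ.≤-refl
nat≥0 (suc k) = +-≥0 0≤1 (nat≥0 k)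

nat-mono : ∀ {a b} → a ≤ b → nat a ≤ℚ nat b
nat-mono {b = b} z≤n = nat≥0 b
nat-mono (s≤s a≤b)   = ℚ.+-monoʳ-≤ 1ℚ (nat-mono a≤b)

nat-strict : ∀ {a b} → a <ℕ b → nat a <ℚ nat b
nat-strict {a} {b} a<b = ℚ.<-≤-trans a<1+a (nat-mono a<b)
  where
  a<1+a : nat a <ℚ 1ℚ + nat a
  a<1+a = subst (_<ℚ 1ℚ + nat a) (ℚ.+-identityˡ (nat a)) (ℚ.+-monoˡ-< (nat a) (ℚ.positive⁻¹ 1ℚ))

nat-injective : ∀ {a b} → nat a ≡ nat b → a ≡ b
nat-injective {a} {b} eq with ℕ.<-cmp a b
... | tri< a<b _ _ = ⊥-elim (ℚ.<-irrefl eq (nat-strict a<b))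
... | tri≈ _ a≡b _ = a≡b
... | tri> _ _ b<a = ⊥-elim (ℚ.<-irrefl (sym eq) (nat-strict b<a))

-- An integer as a difference of two naturals, written without subtraction. Closure under sums and
-- negation is then direct, and comparing `a` with `b` decides whether q ≥ 1, q = 0 or q < 0.
data IsInt (q : ℚ) : Set where
  int : ∀ a b → q + nat a ≡ nat b → IsInt q

int-nat : ∀ k → IsInt (nat k)
int-nat k = int 0 k (ℚ.+-identityʳ (nat k))

int-+ : ∀ {p q} → IsInt p → IsInt q → IsInt (p + q)
int-+ {p} {q} (int a b p≡) (int c d q≡) = int (a Nat.+ c) (b Nat.+ d) (begin
  p + q + nat (a Nat.+ c)   ≡⟨ cong (p + q +_) (nat-+ a c) ⟩
  p + q + (nat a + nat c)
    ≡⟨ solve 4 (λ p q a c → p :+ q :+ (a :+ c) := p :+ a :+ (q :+ c)) refl p q (nat a) (nat c) ⟩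
  p + nat a + (q + nat c)        ≡⟨ cong₂ _+_ p≡ q≡ ⟩
  nat b + nat d                  ≡⟨ nat-+ b d ⟨
  nat (b Nat.+ d)           ∎)

int-neg : ∀ {p} → IsInt p → IsInt (- p)
int-neg {p} (int a b p≡) = int b a (trans (cong (- p +_) (sym p≡))
  (solve 2 (λ p a → :- p :+ (p :+ a) := a) refl p (nat a)))

int-ind : ∀ b → IsInt (ind b)
int-ind true  = int 0 1 refl
int-ind false = int 0 0 refl

int-ind-* : ∀ b {q} → IsInt q → IsInt (ind b * q)
int-ind-* true  {q} i = subst IsInt (sym (ℚ.*-identityˡ q)) i
int-ind-* false {q} i = subst IsInt (sym (ℚ.*-zeroˡ q)) (int-ind false)

int-sum : ∀ {A : Set} (as : List A) {f} → (∀ a → IsInt (f a)) → IsInt (sum as f)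
int-sum []       h = int-ind false
int-sum (a ∷ as) h = int-+ (h a) (int-sum as h)

int-unit : ∀ {q} → IsInt q → 0ℚ ≤ℚ q → q ≤ℚ 1ℚ → q ≡ 0ℚ ⊎ q ≡ 1ℚ
int-unit {q} (int a b eq) 0≤q q≤1 with ℕ.<-cmp a b
... | tri< a<b _ _ = inj₂ (ℚ.≤-antisym q≤1 (≤-by (diff≥0 (nat-mono a<b)) (trans
        (cong (λ z → 1ℚ + (z - (1ℚ + nat a))) (sym eq))
        (solve 2 (λ q a → con 1ℚ :+ (q :+ a :- (con 1ℚ :+ a)) := q) refl q (nat a)))))
... | tri≈ _ refl _ = inj₁ (trans (solve 2 (λ q a → q := q :+ a :- a) refl q (nat a))
        (trans (cong (_- nat a) eq) (ℚ.+-inverseʳ (nat a))))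
... | tri> _ _ b<a = ⊥-elim (ℚ.<-irrefl refl (ℚ.<-≤-trans (nat-strict b<a)
        (≤-by 0≤q (trans (ℚ.+-comm (nat a) q) eq))))

Frac : ∀ {A : Set} → (A → ℚ) → A → Set
Frac y e = y e ≢ 0ℚ × y e ≢ 1ℚ

frac? : ∀ {A : Set} (y : A → ℚ) e → Dec (Frac y e)
frac? y e with y e ℚ.≟ 0ℚ | y e ℚ.≟ 1ℚ
... | yes p | _     = no (λ (h , _) → h p)
... | no _  | yes p = no (λ (_ , h) → h p)
... | no p  | no q  = yes (p , q)

¬frac⇒int : ∀ {A : Set} (y : A → ℚ) e → ¬ Frac y e → y e ≡ 0ℚ ⊎ y e ≡ 1ℚ
¬frac⇒int y e h with y e ℚ.≟ 0ℚ | y e ℚ.≟ 1ℚ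
... | yes p | _     = inj₁ p
... | no _  | yes p = inj₂ p
... | no p  | no q  = ⊥-elim (h (p , q))

isInt-01 : ∀ {q} → q ≡ 0ℚ ⊎ q ≡ 1ℚ → IsInt q
isInt-01 (inj₁ refl) = int-ind false
isInt-01 (inj₂ refl) = int-ind true

-- Coordinates indexed by a finite type

-- `sum-at` encodes that no element is listed twice, in the form in which sums use it: a function
-- supported at one element sums to its value there.
record Enumeration (A : Set) : Set where
  field
    elems    : List A
    _≟ᴬ_     : (a b : A) → Dec (a ≡ b)
    complete : ∀ a → a ∈ elems
    sum-at   : ∀ (f : A → ℚ) a → (∀ b → b ≢ a → f b ≡ 0ℚ) → sum elems f ≡ f a

module _ {A : Set} (E : Enumeration A) where
  open Enumeration E

  basis : A → A → ℚ
  basis e a = ind ⌊ a ≟ᴬ e ⌋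

  basis-≡ : ∀ {e a} → a ≡ e → basis e a ≡ 1ℚ
  basis-≡ {e} {a} eq with a ≟ᴬ e
  ... | yes _ = refl
  ... | no ¬eq = ⊥-elim (¬eq eq)

  basis-≢ : ∀ {e a} → a ≢ e → basis e a ≡ 0ℚ
  basis-≢ {e} {a} ¬eq with a ≟ᴬ e
  ... | yes eq = ⊥-elim (¬eq eq)
  ... | no _ = refl

  dot-basisʳ : ∀ a e → dot elems a (basis e) ≡ a e
  dot-basisʳ a e = trans
    (sum-at _ e (λ b b≢e → trans (cong (a b *_) (basis-≢ b≢e)) (ℚ.*-zeroʳ (a b))))
    (trans (cong (a e *_) (basis-≡ refl)) (ℚ.*-identityʳ (a e)))

  dot-basisˡ : ∀ e y → dot elems (basis e) y ≡ y e
  dot-basisˡ e y = trans (sum-cong elems (λ b → ℚ.*-comm (basis e b) (y b))) (dot-basisʳ y e)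

  module _ {y : A → ℚ} (y≥0 : ∀ a → 0ℚ ≤ℚ y a) (y≤1 : ∀ a → y a ≤ℚ 1ℚ) where

    another-fractional : ∀ (p : A → Bool) → IsInt (dot elems (λ a → ind (p a)) y) →
      ∀ {e} → p e ≡ true → Frac y e → ∃ λ v → v ≢ e × p v ≡ true × Frac y v
    another-fractional p total {e} pe fe with Any.any? other? elems
      where
      other? : ∀ v → Dec (v ≢ e × p v ≡ true × Frac y v)
      other? v with v ≟ᴬ e | p v | frac? y v
      ... | yes v≡e | _     | _      = no (λ (h , _) → h v≡e)
      ... | no _    | false | _      = no (λ { (_ , () , _) })
      ... | no _    | true  | no ¬f  = no (λ (_ , _ , f) → ¬f f)
      ... | no v≢e  | true  | yes f  = yes (v≢e , refl , f)
    ... | yes found = proj₁ (Any.satisfied found) , proj₂ (Any.satisfied found)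
    ... | no none = ⊥-elim (Sum.[ proj₁ fe , proj₂ fe ]′ (int-unit int-ye (y≥0 e) (y≤1 e)))
      where
      -- The terms of the total with that of `e` taken away. If no other selected entry is
      -- fractional, each of them is an integer, and then `y e` is the difference of two integers.
      rest : A → ℚ
      rest v = ind (p v) * y v - basis e v * y e
      rest-int : ∀ v → IsInt (rest v)
      rest-int v with v ≟ᴬ e
      ... | yes refl rewrite pe = int 0 0 (solve 1 (λ q → con 1ℚ :* q :- con 1ℚ :* q :+ con 0ℚ := con 0ℚ) refl (y e))
      ... | no v≢e with p v in pv
      ... | true  = int-+ (int-ind-* true (isInt-01 (¬frac⇒int y v
                      (λ f → none (lose (complete v) (v≢e , pv , f)))))) (int-neg (int-zero (y e)))
        where
        int-zero : ∀ q → IsInt (0ℚ * q)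
        int-zero q = subst IsInt (sym (ℚ.*-zeroˡ q)) (int-ind false)
      ... | false = int 0 0 (solve 2 (λ q r → con 0ℚ :* q :- con 0ℚ :* r :+ con 0ℚ := con 0ℚ) refl (y v) (y e))
      split : sum elems (λ v → ind (p v) * y v) ≡ sum elems rest + y e
      split = begin
        sum elems (λ v → ind (p v) * y v)
          ≡⟨ sum-cong elems (λ v → solve 2 (λ a b → a := a :- b :+ b) refl (ind (p v) * y v) (basis e v * y e)) ⟩
        sum elems (λ v → rest v + basis e v * y e)
          ≡⟨ sum-+ elems rest _ ⟩
        sum elems rest + dot elems (basis e) (λ _ → y e)
          ≡⟨ cong (sum elems rest +_) (dot-basisˡ e (λ _ → y e)) ⟩
        sum elems rest + y e ∎
      int-ye : IsInt (y e)
      int-ye = subst IsInt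
        (trans (cong (_- sum elems rest) split)
               (solve 2 (λ s q → s :+ q :- s := q) refl (sum elems rest) (y e)))
        (int-+ total (int-neg (int-sum elems rest-int)))

  -- σ pairs up the fractional elements, R relates those lying in the same tight
  -- constraints.
  module AlternatingCycles (y : A → ℚ) (σ : A → A) (R : A → A → Set)
    (σ-frac : ∀ {e} → Frac y e → Frac y (σ e))
    (σ-inv : ∀ {e} → Frac y e → σ (σ e) ≡ e)
    (σ-≢ : ∀ {e} → Frac y e → σ e ≢ e)
    (R-refl : ∀ {e} → Frac y e → R e e)
    (R-trans : ∀ {a b c} → R a b → R b c → R a c)
    (partner : ∀ {u} → Frac y u → ∃ λ v → v ≢ u × Frac y v × R v u)
    where

    -- A listed element a stands for the pair {a, σ a}: the path enters the pair at a, crosses to σ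
    -- a, and passes by `R` to the next listed element.
    data Path : A → A → List A → Set where
      stop : ∀ {a} → Frac y a → Path a a (a ∷ [])
      step : ∀ {a b z L} → Frac y a → R (σ a) b → Path b z L → Path a z (a ∷ L)

    -- Both elements name the same pair.
    Clash : A → A → Set
    Clash a b = a ≡ b ⊎ a ≡ σ b

    clash? : ∀ a b → Dec (Clash a b)
    clash? a b with a ≟ᴬ b | a ≟ᴬ σ b
    ... | yes p | _     = yes (inj₁ p)
    ... | no _  | yes q = yes (inj₂ q)
    ... | no p  | no q  = no Sum.[ p , q ]′

    Tail : (A → Set) → List A → Set
    Tail P []      = ⊤
    Tail P (_ ∷ L) = All P L

    path-frac : ∀ {a z L} → Path a z L → All (Frac y) L
    path-frac (stop f)     = f ∷ []
    path-frac (step f _ p) = f ∷ path-frac p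

    head-frac : ∀ {a z L} → Path a z L → Frac y a
    head-frac (stop f)     = f
    head-frac (step f _ p) = f

    -- The path is cut where it meets the pair of `g`: at the listed element if `g` is its mate,
    -- just before it if `g` is the element itself. Either way the last crossing leads by `R` to
    -- `g`; `g ≢ a` excludes the case in which nothing comes before.
    truncate : ∀ {P : A → Set} {a z L g} → Path a z L → All P L → Any (Clash g) L → g ≢ a →
               ∃ λ c → ∃ λ L′ → Path a c L′ × R (σ c) g × All P L′
    truncate p pL (here (inj₁ g≡a)) g≢a with p
    ... | stop _     = ⊥-elim (g≢a g≡a)
    ... | step _ _ _ = ⊥-elim (g≢a g≡a)
    truncate (stop f) (h ∷ _) (here (inj₂ refl)) g≢a =
      _ , _ , stop f , R-refl (σ-frac f) , h ∷ []
    truncate (step f r p) (h ∷ _) (here (inj₂ refl)) g≢a =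
      _ , _ , stop f , R-refl (σ-frac f) , h ∷ []
    truncate {g = g} (step {b = b} f r p) (h ∷ hs) (there t) g≢a with g ≟ᴬ b
    ... | yes refl = _ , _ , stop f , r , h ∷ []
    ... | no g≢b with truncate p hs t g≢b
    ... | c , L′ , p′ , r′ , hs′ = c , _ , step f r p′ , r′ , h ∷ hs′

    -- Only the start has to be free of clashes. That alone gives the flow the value 1 there, so it
    -- cannot vanish; pairs met again later do no harm.
    record Cycle : Set where
      constructor cycle
      field
        {start end} : A
        {vertices}  : List A
        path        : Path start end vertices
        closed      : R (σ end) start
        simple      : Tail (λ b → ¬ Clash start b) vertices

    -- The next element is σ g, so the path closes up at b if σ g = b, and just
    -- before b if σ g = σ b.
    close : ∀ {a z L g} → Path a z L → Tail (λ b → ¬ Clash a b) L → Any (Clash g) L →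
            g ≢ a → R g a → Cycle
    close (stop f) _ (here (inj₁ g≡a)) g≢a r = ⊥-elim (g≢a g≡a)
    -- The related element `g` is the mate of `a`, so this one pair already closes up.
    close (stop f) _ (here (inj₂ refl)) g≢a r = cycle (stop f) r []
    close (step f _ p) _ (here (inj₁ g≡a)) g≢a r = ⊥-elim (g≢a g≡a)
    close (step f _ p) _ (here (inj₂ refl)) g≢a r = cycle (stop f) r []
    close {g = g} (step {b = b} f s p) hs (there t) g≢a r with g ≟ᴬ b
    -- With g = b, `R` leads from σ a through b back to a, so again a single pair is a cycle.
    ... | yes refl = cycle (stop f) (R-trans s r) []
    ... | no g≢b with truncate p hs t g≢b
    ... | c , L′ , p′ , r′ , hs′ = cycle (step f s p′) (R-trans r′ r) hs′

    fresh : List A → A → Bool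
    fresh L e = not ⌊ Any.any? (e ≟ᴬ_) L ⌋

    #fresh : List A → ℕ
    #fresh L = length (filterB (fresh L) elems)

    fresh-∷ : ∀ a L e → fresh L e ≡ false → fresh (a ∷ L) e ≡ false
    fresh-∷ a L e h with Any.any? (e ≟ᴬ_) L | Any.any? (e ≟ᴬ_) (a ∷ L)
    ... | yes _   | yes _ = refl
    ... | yes e∈L | no e∉ = ⊥-elim (e∉ (there e∈L))

    fresh-head : ∀ a L → fresh (a ∷ L) a ≡ false
    fresh-head a L with Any.any? (a ≟ᴬ_) (a ∷ L)
    ... | yes _ = refl
    ... | no a∉ = ⊥-elim (a∉ (here refl))

    fresh-∉ : ∀ a L → ¬ a ∈ L → fresh L a ≡ true
    fresh-∉ a L a∉ with Any.any? (a ≟ᴬ_) L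
    ... | yes a∈ = ⊥-elim (a∉ a∈)
    ... | no _ = refl

    #fresh-∷ : ∀ {a L} → ¬ a ∈ L → #fresh (a ∷ L) <ℕ #fresh L
    #fresh-∷ {a} {L} a∉ = filterB-length-< (fresh L) (fresh (a ∷ L))
      (All.tabulate (λ {e} _ → fresh-∷ a L e))
      (lose (complete a) (fresh-∉ a L a∉ , fresh-head a L))

    -- The path grows at its head `a`. For a partner `g` of `a`, the element σ g crosses to g, which
    -- is related to `a`; it is prepended if its pair is new, and otherwise the path closes at `a`.
    -- Unlisted elements run out.
    grow : ∀ k {a z L} → #fresh L <ℕ k → Path a z L → AllPairs (λ a b → ¬ Clash a b) L → Cycle
    grow (suc k) {a} {z} {L} bound p apart with partner (head-frac p)
    ... | g , g≢a , fg , r with Any.any? (clash? g) L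
    ... | yes hit = close p (tail-apart p apart) hit g≢a r
      where
      tail-apart : ∀ {a z L} → Path a z L → AllPairs (λ a b → ¬ Clash a b) L →
                   Tail (λ b → ¬ Clash a b) L
      tail-apart (stop _)     (h ∷ _) = h
      tail-apart (step _ _ _) (h ∷ _) = h
    ... | no miss = grow k
      (ℕ.≤-trans (#fresh-∷ (λ σg∈L → All.lookup new σg∈L (inj₁ refl))) (ℕ.≤-pred bound))
      (step (σ-frac fg) (subst (λ v → R v a) (sym (σ-inv fg)) r) p) (new ∷ apart)
      where
      new : All (λ b → ¬ Clash (σ g) b) L
      new = All.zipWith
        (λ { (fb , ¬c) (inj₁ σg≡b)  → ¬c (inj₂ (trans (sym (σ-inv fg)) (cong σ σg≡b)))
           ; (fb , ¬c) (inj₂ σg≡σb) → ¬c (inj₁ (trans (sym (σ-inv fg)) (trans (cong σ σg≡σb) (σ-inv fb)))) })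
        (path-frac p , Allₚ.¬Any⇒All¬ L miss)

    cycle-from : ∀ {u} → Frac y u → Cycle
    cycle-from f = grow _ ℕ.≤-refl (stop f) ([] ∷ [])

    jump : A → A → ℚ
    jump a e = basis a e - basis (σ a) e

    flow : List A → A → ℚ
    flow []      e = 0ℚ
    flow (a ∷ L) e = jump a e + flow L e

    dot-jump : ∀ c a → dot elems c (jump a) ≡ c a - c (σ a)
    dot-jump c a = begin
      dot elems c (jump a)
        ≡⟨ dot-congʳ elems c (λ e → solve 2 (λ p q → p :- q := p :+ con (- 1ℚ) :* q) refl (basis a e) (basis (σ a) e)) ⟩
      dot elems c (λ e → basis a e + - 1ℚ * basis (σ a) e)
        ≡⟨ dot-+ʳ elems c (basis a) _ ⟩
      dot elems c (basis a) + dot elems c (λ e → - 1ℚ * basis (σ a) e)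
        ≡⟨ cong₂ _+_ (dot-basisʳ c a) (trans (dot-*ʳ elems c (- 1ℚ) (basis (σ a))) (cong (- 1ℚ *_) (dot-basisʳ c (σ a)))) ⟩
      c a + - 1ℚ * c (σ a)
        ≡⟨ solve 2 (λ p q → p :+ con (- 1ℚ) :* q := p :- q) refl (c a) (c (σ a)) ⟩
      c a - c (σ a) ∎

    -- The sum telescopes: `c` agrees on σ a and the next listed element, so consecutive jumps
    -- cancel up to the two ends. On a closed cycle the ends cancel as well.
    dot-flow : ∀ c → (∀ {u v} → R u v → c u ≡ c v) → ∀ {a z L} → Path a z L →
               dot elems c (flow L) ≡ c a - c (σ z)
    dot-flow c resp {a} (stop f) = trans
      (dot-congʳ elems c (λ e → ℚ.+-identityʳ (jump a e))) (dot-jump c a)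
    dot-flow c resp {a} {z} {_ ∷ L} (step {b = b} f r p) = begin
      dot elems c (flow (a ∷ L))                         ≡⟨ dot-+ʳ elems c (jump a) (flow L) ⟩
      dot elems c (jump a) + dot elems c (flow L)        ≡⟨ cong₂ _+_ (dot-jump c a) (dot-flow c resp p) ⟩
      c a - c (σ a) + (c b - c (σ z))                    ≡⟨ cong (λ q → c a - q + (c b - c (σ z))) (resp r) ⟩
      c a - c b + (c b - c (σ z))
        ≡⟨ solve 3 (λ p q s → p :- q :+ (q :- s) := p :- s) refl (c a) (c b) (c (σ z)) ⟩
      c a - c (σ z) ∎

    flow-0 : ∀ {e L} → All (λ b → ¬ Clash e b) L → flow L e ≡ 0ℚ
    flow-0 []       = refl
    flow-0 {e} {b ∷ L} (h ∷ hs) = cong₂ _+_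
      (cong₂ (λ p q → p - q) (basis-≢ (λ eq → h (inj₁ eq))) (basis-≢ (λ eq → h (inj₂ eq)))) (flow-0 hs)

    flow-off : ∀ {e a z L} → ¬ Frac y e → Path a z L → flow L e ≡ 0ℚ
    flow-off {e} ¬f p = flow-0 (All.map
      (λ { f (inj₁ refl) → ¬f f ; f (inj₂ refl) → ¬f (σ-frac f) }) (path-frac p))

    flow-start : ∀ {a z L} → Path a z L → Tail (λ b → ¬ Clash a b) L → flow L a ≡ 1ℚ
    flow-start (stop f) _ = cong₂ (λ p q → p - q + 0ℚ) (basis-≡ refl) (basis-≢ (λ eq → σ-≢ f (sym eq)))
    flow-start (step f _ p) hs = cong₂ _+_
      (cong₂ (λ p q → p - q) (basis-≡ refl) (basis-≢ (λ eq → σ-≢ f (sym eq)))) (flow-0 hs)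

    basis-swap : ∀ {p q a} → σ p ≡ q → σ q ≡ p → Frac y a → basis a p ≡ basis (σ a) q
    basis-swap {p} {q} {a} σp σq f with p ≟ᴬ a
    ... | yes refl = sym (basis-≡ (sym σp))
    ... | no p≢a   = sym (basis-≢ (λ q≡σa → p≢a (trans (sym σq) (trans (cong σ q≡σa) (σ-inv f)))))

    -- Exchanging the members of a pair changes the sign of every jump, since σ exchanges the unit
    -- vectors at a and σ a.
    flow-pair : ∀ {p q a z L} → σ p ≡ q → σ q ≡ p → Path a z L → flow L p + flow L q ≡ 0ℚ
    flow-pair {p} {q} σp σq path = go (path-frac path)
      where
      go : ∀ {L} → All (Frac y) L → flow L p + flow L q ≡ 0ℚ
      go [] = refl
      go {a ∷ L} (f ∷ fs) = begin
        jump a p + flow L p + (jump a q + flow L q)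
          ≡⟨ cong₂ (λ s t → s - basis (σ a) p + flow L p + (t - basis (σ a) q + flow L q))
               (basis-swap σp σq f) (basis-swap σq σp f) ⟩
        basis (σ a) q - basis (σ a) p + flow L p + (basis (σ a) p - basis (σ a) q + flow L q)
          ≡⟨ solve 4 (λ s t u v → s :- t :+ u :+ (t :- s :+ v) := u :+ v) refl
               (basis (σ a) q) (basis (σ a) p) (flow L p) (flow L q) ⟩
        flow L p + flow L q
          ≡⟨ go fs ⟩
        0ℚ ∎

-- Edges and vertex sets of K_n

sum-concatMap : ∀ {A B : Set} (g : A → List B) as (f : B → ℚ) →
                sum (concatMap g as) f ≡ sum as (λ a → sum (g a) f)
sum-concatMap g []       f = refl
sum-concatMap g (a ∷ as) f = trans (sum-++ (g a) (concatMap g as) f)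
  (cong (sum (g a) f +_) (sum-concatMap g as f))

sum-tabulate-at : ∀ {B : Set} {m} (g : Fin m → B) (f : B → ℚ) i →
                  (∀ j → j ≢ i → f (g j) ≡ 0ℚ) → sum (tabulate g) f ≡ f (g i)
sum-tabulate-at g f Fin.zero h = trans
  (cong (f (g Fin.zero) +_) (zeros (λ j → g (Fin.suc j)) (λ j → h (Fin.suc j) λ ())))
  (ℚ.+-identityʳ _)
  where
  zeros : ∀ {m} (g : Fin m → _) → (∀ j → f (g j) ≡ 0ℚ) → sum (tabulate g) f ≡ 0ℚ
  zeros {zero}  g z = refl
  zeros {suc m} g z = cong₂ _+_ (z Fin.zero) (zeros (λ j → g (Fin.suc j)) (λ j → z (Fin.suc j)))
sum-tabulate-at g f (Fin.suc i) h = trans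
  (cong₂ _+_ (h Fin.zero λ ())
    (sum-tabulate-at (λ j → g (Fin.suc j)) f i (λ j j≢i → h (Fin.suc j) (λ eq → j≢i (Fin.suc-injective eq)))))
  (ℚ.+-identityˡ _)

edge-≡ : ∀ {n} {e f : Edge n} → lo e ≡ lo f → hi e ≡ hi f → e ≡ f
edge-≡ {e = edge l h p} {edge .l .h q} refl refl = cong (edge l h) (ℕ.<-irrelevant p q)

lo≢hi : ∀ {n} (e : Edge n) → lo e ≢ hi e
lo≢hi e eq = ℕ.<-irrefl (cong Fin.toℕ eq) (lo<hi e)

edge-≟ : ∀ {n} (e f : Edge n) → Dec (e ≡ f)
edge-≟ e f with lo e Fin.≟ lo f | hi e Fin.≟ hi f
... | yes p | yes q = yes (edge-≡ p q)
... | no ¬p | _     = no (λ eq → ¬p (cong lo eq))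
... | yes _ | no ¬q = no (λ eq → ¬q (cong hi eq))

sum-edgeIf : ∀ {n} (f : Edge n → ℚ) i j → (∀ e → lo e ≡ i → hi e ≡ j → f e ≡ 0ℚ) →
             sum (edgeIf i j) f ≡ 0ℚ
sum-edgeIf f i j z with i Fin.<? j
... | yes p = trans (ℚ.+-identityʳ _) (z (edge i j p) refl refl)
... | no _  = refl

sum-edgeIf-at : ∀ {n} (f : Edge n → ℚ) e → sum (edgeIf (lo e) (hi e)) f ≡ f e
sum-edgeIf-at f e with lo e Fin.<? hi e
... | yes p = trans (ℚ.+-identityʳ _) (cong f (edge-≡ refl refl))
... | no ¬p = ⊥-elim (¬p (lo<hi e))

∈-edgeIf : ∀ {n} (e : Edge n) → e ∈ edgeIf (lo e) (hi e)
∈-edgeIf e with lo e Fin.<? hi e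
... | yes p = here (edge-≡ refl refl)
... | no ¬p = ⊥-elim (¬p (lo<hi e))

edges : ∀ n → Enumeration (Edge n)
edges n = record
  { elems    = allEdges n
  ; _≟ᴬ_     = edge-≟
  ; complete = λ e → ∈-concatMap⁺ (λ i → concatMap (edgeIf i) (allFin n))
      (lose (∈-allFin (lo e)) (∈-concatMap⁺ (edgeIf (lo e)) (lose (∈-allFin (hi e)) (∈-edgeIf e))))
  ; sum-at   = at
  }
  where
  at : ∀ (f : Edge n → ℚ) e → (∀ g → g ≢ e → f g ≡ 0ℚ) → sum (allEdges n) f ≡ f e
  at f e z = begin
    sum (allEdges n) f
      ≡⟨ sum-concatMap (λ i → concatMap (edgeIf i) (allFin n)) (allFin n) f ⟩
    sum (allFin n) (λ i → sum (concatMap (edgeIf i) (allFin n)) f)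
      ≡⟨ sum-cong (allFin n) (λ i → sum-concatMap (edgeIf i) (allFin n) f) ⟩
    sum (allFin n) (λ i → sum (allFin n) (λ j → sum (edgeIf i j) f))
      ≡⟨ sum-tabulate-at (λ i → i) _ (lo e) (λ i i≢ → trans
           (sum-cong (allFin n) (λ j → sum-edgeIf f i j
             (λ g g≡i _ → z g (λ eq → i≢ (trans (sym g≡i) (cong lo eq))))))
           (sum-0 (allFin n))) ⟩
    sum (allFin n) (λ j → sum (edgeIf (lo e) j) f)
      ≡⟨ sum-tabulate-at (λ j → j) _ (hi e) (λ j j≢ → sum-edgeIf f (lo e) j
           (λ g _ g≡j → z g (λ eq → j≢ (trans (sym g≡j) (cong hi eq))))) ⟩
    sum (edgeIf (lo e) (hi e)) f
      ≡⟨ sum-edgeIf-at f e ⟩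
    f e ∎

extend : ∀ {n} → Bool → VSet n → VSet (suc n)
extend b S Fin.zero    = b
extend b S (Fin.suc v) = S v

subsets : ∀ n → List (VSet n)
subsets zero    = (λ ()) ∷ []
subsets (suc n) = map (extend true) (subsets n) ++ map (extend false) (subsets n)

-- A set given by a function is listed only up to pointwise equality; `size-cong` and `mass-cong`
-- carry results over to the listed copy.
subsets-complete : ∀ {n} (S : VSet n) → Any (λ S′ → ∀ v → S′ v ≡ S v) (subsets n)
subsets-complete {zero}  S = here (λ ())
subsets-complete {suc n} S with S Fin.zero in S0
... | true  = Anyₚ.++⁺ˡ (Anyₚ.map⁺ (Any.map
                (λ eq → λ { Fin.zero → sym S0 ; (Fin.suc v) → eq v })
                (subsets-complete (λ v → S (Fin.suc v)))))
... | false = Anyₚ.++⁺ʳ (map (extend true) (subsets n)) (Anyₚ.map⁺ (Any.map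
                (λ eq → λ { Fin.zero → sym S0 ; (Fin.suc v) → eq v })
                (subsets-complete (λ v → S (Fin.suc v)))))

∧-true : ∀ {a b} → a ≡ true → b ≡ true → a ∧ b ≡ true
∧-true refl refl = refl

∧-trueˡ : ∀ {a b} → a ∧ b ≡ true → a ≡ true
∧-trueˡ {true} _ = refl

∧-trueʳ : ∀ {a b} → a ∧ b ≡ true → b ≡ true
∧-trueʳ {true} h = h

∨-trueˡ : ∀ {a b} → a ≡ true → a ∨ b ≡ true
∨-trueˡ refl = refl

∨-trueʳ : ∀ {a b} → b ≡ true → a ∨ b ≡ true
∨-trueʳ {true}  _ = refl
∨-trueʳ {false} h = h

true≢false : ∀ {b} → b ≡ true → b ≡ false → ⊥
true≢false refl ()

¬true⇒false : ∀ {b} → b ≢ true → b ≡ false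
¬true⇒false {true}  h = ⊥-elim (h refl)
¬true⇒false {false} h = refl

-- Sizes and masses of vertex sets

module _ {n : ℕ} where

  infixr 6 _∪_ _∩_
  infix 4 _⊆_

  _∪_ _∩_ : VSet n → VSet n → VSet n
  (S ∪ T) v = S v ∨ T v
  (S ∩ T) v = S v ∧ T v

  _⊆_ : VSet n → VSet n → Set
  S ⊆ T = ∀ v → S v ≡ true → T v ≡ true

  Disjoint : VSet n → VSet n → Set
  Disjoint S T = ∀ v → S v ≡ true → T v ≡ true → ⊥

  inside : VSet n → Edge n → Bool
  inside S e = S (lo e) ∧ S (hi e)

  -- The edges with one end in S only and the other in T only.
  between : VSet n → VSet n → Edge n → Bool
  between S T e = inside (S ∪ T) e ∧ not (inside S e ∨ inside T e)

  size : VSet n → ℚ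
  size S = sum (allFin n) (λ v → ind (S v))

  inner : (Edge n → Bool) → (Edge n → ℚ) → ℚ
  inner p y = dot (allEdges n) (λ e → ind (p e)) y

  mass : (Edge n → ℚ) → VSet n → ℚ
  mass y S = inner (inside S) y

  inside-⊆ : ∀ {S T} → S ⊆ T → ∀ e → inside S e ≡ true → inside T e ≡ true
  inside-⊆ {S} {T} S⊆T e h =
    ∧-true (S⊆T (lo e) (∧-trueˡ {S (lo e)} h)) (S⊆T (hi e) (∧-trueʳ {S (lo e)} h))

  inside-∩ : ∀ S T e → inside S e ≡ true → inside T e ≡ true → inside (S ∩ T) e ≡ true
  inside-∩ S T e h k = ∧-true
    (∧-true (∧-trueˡ {S (lo e)} h) (∧-trueˡ {T (lo e)} k))
    (∧-true (∧-trueʳ {S (lo e)} h) (∧-trueʳ {T (lo e)} k))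

  inner-cong : ∀ {p q} y → (∀ e → p e ≡ q e) → inner p y ≡ inner q y
  inner-cong y eq = dot-congˡ (allEdges n) y (λ e → cong ind (eq e))

  inner-+ : ∀ p q s y → (∀ e → ind (p e) + ind (q e) ≡ ind (s e)) →
            inner p y + inner q y ≡ inner s y
  inner-+ p q s y eq = trans (sym (dot-+ˡ (allEdges n) (λ e → ind (p e)) (λ e → ind (q e)) y)) (dot-congˡ (allEdges n) y eq)

  size-cong : ∀ {S T : VSet n} → (∀ v → S v ≡ T v) → size S ≡ size T
  size-cong eq = sum-cong (allFin n) (λ v → cong ind (eq v))

  mass-cong : ∀ {S T} y → (∀ v → S v ≡ T v) → mass y S ≡ mass y T
  mass-cong y eq = inner-cong y (λ e → cong₂ _∧_ (eq (lo e)) (eq (hi e)))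

  size-int : ∀ S → IsInt (size S)
  size-int S = int-sum (allFin n) (λ v → int-ind (S v))

  size-modular : ∀ S T → size (S ∪ T) + size (S ∩ T) ≡ size S + size T
  size-modular S T = begin
    size (S ∪ T) + size (S ∩ T)                          ≡⟨ sum-+ (allFin n) _ _ ⟨
    sum (allFin n) (λ v → ind (S v ∨ T v) + ind (S v ∧ T v))
      ≡⟨ sum-cong (allFin n) (λ v → bool (S v) (T v)) ⟩
    sum (allFin n) (λ v → ind (S v) + ind (T v))         ≡⟨ sum-+ (allFin n) _ _ ⟩
    size S + size T                                      ∎
    where
    bool : ∀ a b → ind (a ∨ b) + ind (a ∧ b) ≡ ind a + ind b
    bool true  true  = refl
    bool true  false = refl
    bool false b = ℚ.+-comm (ind b) 0ℚ

  -- An equality with explicit excess instead of an inequality: uncrossing has to conclude that the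
  -- excess vanishes.
  mass-supermodular : ∀ y S T →
    mass y (S ∪ T) + mass y (S ∩ T) ≡ mass y S + mass y T + inner (between S T) y
  mass-supermodular y S T = begin
    mass y (S ∪ T) + mass y (S ∩ T)
      ≡⟨ dot-+ˡ (allEdges n) (λ e → ind (inside (S ∪ T) e)) (λ e → ind (inside (S ∩ T) e)) y ⟨
    dot (allEdges n) (λ e → ind (inside (S ∪ T) e) + ind (inside (S ∩ T) e)) y
      ≡⟨ dot-congˡ (allEdges n) y (λ e → bool (S (lo e)) (S (hi e)) (T (lo e)) (T (hi e))) ⟩
    dot (allEdges n) (λ e → ind (inside S e) + ind (inside T e) + ind (between S T e)) y
      ≡⟨ dot-+ˡ (allEdges n) (λ e → ind (inside S e) + ind (inside T e)) (λ e → ind (between S T e)) y ⟩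
    dot (allEdges n) (λ e → ind (inside S e) + ind (inside T e)) y + inner (between S T) y
      ≡⟨ cong (_+ inner (between S T) y) (dot-+ˡ (allEdges n) (λ e → ind (inside S e)) (λ e → ind (inside T e)) y) ⟩
    mass y S + mass y T + inner (between S T) y ∎
    where
    bool : ∀ a b c d →
      ind ((a ∨ c) ∧ (b ∨ d)) + ind ((a ∧ c) ∧ (b ∧ d)) ≡
      ind (a ∧ b) + ind (c ∧ d) + ind (((a ∨ c) ∧ (b ∨ d)) ∧ not (a ∧ b ∨ c ∧ d))
    bool true  true  true  true  = refl
    bool true  true  true  false = refl
    bool true  true  false true  = refl
    bool true  true  false false = refl
    bool true  false true  true  = refl
    bool true  false true  false = refl
    bool true  false false true  = refl
    bool true  false false false = refl
    bool false true  true  true  = refl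
    bool false true  true  false = refl
    bool false true  false true  = refl
    bool false true  false false = refl
    bool false false true  true  = refl
    bool false false true  false = refl
    bool false false false true  = refl
    bool false false false false = refl

  inner≥0 : ∀ p {y} → (∀ e → 0ℚ ≤ℚ y e) → 0ℚ ≤ℚ inner p y
  inner≥0 p y≥0 = dot-≥0 (allEdges n) (λ e → ind≥0 (p e)) y≥0

  inner≥term : ∀ p {y} → (∀ e → 0ℚ ≤ℚ y e) → ∀ {e} → p e ≡ true → y e ≤ℚ inner p y
  inner≥term p {y} y≥0 {e} pe = subst (_≤ℚ inner p y)
    (trans (cong (λ b → ind b * y e) pe) (ℚ.*-identityˡ (y e)))
    (term≤sum (λ g → *-≥0 (ind≥0 (p g)) (y≥0 g)) (Enumeration.complete (edges n) e))

-- The 1-tree polytope and uncrossing of tight sets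

module _ {n : ℕ} (r : Fin n) where

  others : VSet n
  others v = not (single r v)

  -- Edmonds' description of the spanning tree polytope on the vertices other than `r`, together
  -- with degree 2 at `r`. Adding 1 on the left replaces |S| - 1 on the right.
  record Forest (y : Edge n → ℚ) : Set where
    field
      y≥0    : ∀ e → 0ℚ ≤ℚ y e
      y≤1    : ∀ e → y e ≤ℚ 1ℚ
      sparse : ∀ S → S r ≡ false → (∃ λ v → S v ≡ true) → mass y S + 1ℚ ≤ℚ size S
      full   : mass y others + 1ℚ ≡ size others
      root   : inner (incident r) y ≡ 2ℚ

  record TightSet (y : Edge n → ℚ) (S : VSet n) : Set where
    constructor tightSet
    field
      avoids : S r ≡ false
      member : ∃ λ v → S v ≡ true
      count  : mass y S + 1ℚ ≡ size S
  open TightSet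

  others-r : others r ≡ false
  others-r = cong not (dec-true′ r)
    where
    dec-true′ : ∀ v → ⌊ v Fin.≟ v ⌋ ≡ true
    dec-true′ v with v Fin.≟ v
    ... | yes _ = refl
    ... | no ¬p = ⊥-elim (¬p refl)

  others-⊇ : ∀ {S} → S r ≡ false → S ⊆ others
  others-⊇ {S} Sr v Sv with v Fin.≟ r
  ... | yes refl = ⊥-elim (true≢false Sv Sr)
  ... | no _ = refl

  ≢⇒others : ∀ {v} → v ≢ r → others v ≡ true
  ≢⇒others {v} v≢r with v Fin.≟ r
  ... | yes eq = ⊥-elim (v≢r eq)
  ... | no _ = refl

  incident-others : ∀ e → incident r e ≡ not (inside others e)
  incident-others e with lo e Fin.≟ r | hi e Fin.≟ r
  ... | yes p | yes q = ⊥-elim (lo≢hi e (trans p (sym q)))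
  ... | yes _ | no _  = refl
  ... | no _  | yes _ = refl
  ... | no _  | no _  = refl

  inside⇒¬incident : ∀ {S e} → S r ≡ false → inside S e ≡ true → incident r e ≡ false
  inside⇒¬incident {S} {e} Sr h = trans (incident-others e)
    (cong not (inside-⊆ {S = S} {T = others} (others-⊇ Sr) e h))

  tight? : ∀ y S → Dec (TightSet y S)
  tight? y S with S r Bool.≟ false | Fin.any? (λ v → S v Bool.≟ true) | mass y S + 1ℚ ℚ.≟ size S
  ... | yes p | yes q | yes s = yes (tightSet p q s)
  ... | no ¬p | _     | _     = no (λ t → ¬p (avoids t))
  ... | yes _ | no ¬q | _     = no (λ t → ¬q (member t))
  ... | yes _ | yes _ | no ¬s = no (λ t → ¬s (count t))

  -- The arithmetic of uncrossing, with join, meet and the two given sets in the order a, b, c, d.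
  -- The slacks of join and meet and the excess `m` are nonnegative and sum to 0, so all three
  -- vanish.
  squeeze : ∀ a b c d {s t u v} m → a + b ≡ c + d + m → s + t ≡ u + v → c + 1ℚ ≡ u → d + 1ℚ ≡ v →
            a + 1ℚ ≤ℚ s → b + 1ℚ ≤ℚ t → 0ℚ ≤ℚ m → a + 1ℚ ≡ s × b + 1ℚ ≡ t × m ≤ℚ 0ℚ
  squeeze a b c d {s} {t} m e₁ e₂ refl refl h k 0≤m =
    ℚ.≤-antisym h (≤-by (+-≥0 k′ 0≤m) (alg₁ a b c d s t m e₁ e₂)) ,
    ℚ.≤-antisym k (≤-by (+-≥0 h′ 0≤m) (alg₁ b a c d t s m (trans (ℚ.+-comm b a) e₁) (trans (ℚ.+-comm t s) e₂))) ,
    ≤-by (+-≥0 h′ k′) (alg₂ a b c d s t m e₁ e₂)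
    where
    h′ : 0ℚ ≤ℚ s - (a + 1ℚ)
    h′ = diff≥0 h
    k′ : 0ℚ ≤ℚ t - (b + 1ℚ)
    k′ = diff≥0 k
    alg₁ : ∀ a b c d s t m → a + b ≡ c + d + m → s + t ≡ c + 1ℚ + (d + 1ℚ) →
           s + (t - (b + 1ℚ) + m) ≡ a + 1ℚ
    alg₁ a b c d s t m e₁ e₂ = begin
      s + (t - (b + 1ℚ) + m)
        ≡⟨ solve 5 (λ a b s t m → s :+ (t :- (b :+ con 1ℚ) :+ m)
                      := s :+ t :+ m :+ a :- (a :+ b) :- con 1ℚ) refl a b s t m ⟩
      s + t + m + a - (a + b) - 1ℚ
        ≡⟨ cong₂ (λ p q → p + m + a - q - 1ℚ) e₂ e₁ ⟩
      c + 1ℚ + (d + 1ℚ) + m + a - (c + d + m) - 1ℚ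
        ≡⟨ solve 4 (λ a c d m → c :+ con 1ℚ :+ (d :+ con 1ℚ) :+ m :+ a :- (c :+ d :+ m) :- con 1ℚ
                      := a :+ con 1ℚ) refl a c d m ⟩
      a + 1ℚ ∎
    alg₂ : ∀ a b c d s t m → a + b ≡ c + d + m → s + t ≡ c + 1ℚ + (d + 1ℚ) →
           m + (s - (a + 1ℚ) + (t - (b + 1ℚ))) ≡ 0ℚ
    alg₂ a b c d s t m e₁ e₂ = begin
      m + (s - (a + 1ℚ) + (t - (b + 1ℚ)))
        ≡⟨ solve 5 (λ a b s t m → m :+ (s :- (a :+ con 1ℚ) :+ (t :- (b :+ con 1ℚ)))
                      := m :+ (s :+ t) :- (a :+ b) :- con 1ℚ :- con 1ℚ) refl a b s t m ⟩
      m + (s + t) - (a + b) - 1ℚ - 1ℚ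
        ≡⟨ cong₂ (λ p q → m + p - q - 1ℚ - 1ℚ) e₂ e₁ ⟩
      m + (c + 1ℚ + (d + 1ℚ)) - (c + d + m) - 1ℚ - 1ℚ
        ≡⟨ solve 3 (λ c d m → m :+ (c :+ con 1ℚ :+ (d :+ con 1ℚ)) :- (c :+ d :+ m) :- con 1ℚ :- con 1ℚ
                      := con 0ℚ) refl c d m ⟩
      0ℚ ∎

  module _ {y : Edge n → ℚ} (forest : Forest y) where
    open Forest forest

    record Uncrossed (S T : VSet n) : Set where
      field
        join    : TightSet y (S ∪ T)
        meet    : TightSet y (S ∩ T)
        no-edge : ∀ e → y e ≢ 0ℚ → inside S e ≡ false → inside T e ≡ false →
                  inside (S ∪ T) e ≡ false
    open Uncrossed

    -- Mass is supermodular while size is modular. The common vertex `w` makes the meet nonempty, so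
    -- that `sparse` bounds it too.
    uncross : ∀ {S T w} → TightSet y S → TightSet y T → S w ≡ true → T w ≡ true → Uncrossed S T
    uncross {S} {T} {w} tS tT Sw Tw = conclude
      (squeeze (mass y (S ∪ T)) (mass y (S ∩ T)) (mass y S) (mass y T) (inner (between S T) y)
        (mass-supermodular y S T) (size-modular S T) (count tS) (count tT)
        (sparse (S ∪ T) ∪r (w , ∨-trueˡ Sw)) (sparse (S ∩ T) ∩r (w , ∧-true Sw Tw))
        (inner≥0 (between S T) y≥0))
      where
      ∪r : S r ∨ T r ≡ false
      ∪r = cong₂ _∨_ (avoids tS) (avoids tT)
      ∩r : S r ∧ T r ≡ false
      ∩r = cong₂ _∧_ (avoids tS) (avoids tT)
      conclude : mass y (S ∪ T) + 1ℚ ≡ size (S ∪ T) × mass y (S ∩ T) + 1ℚ ≡ size (S ∩ T) ×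
                 inner (between S T) y ≤ℚ 0ℚ → Uncrossed S T
      conclude (c∪ , c∩ , m≤0) = record
        { join = tightSet ∪r (w , ∨-trueˡ Sw) c∪
        ; meet = tightSet ∩r (w , ∧-true Sw Tw) c∩
        ; no-edge = λ e ye≢0 Se Te → ¬true⇒false (λ h → ye≢0 (ℚ.≤-antisym
            (ℚ.≤-trans (inner≥term (between S T) y≥0 {e}
              (∧-true h (cong not (cong₂ _∨_ Se Te)))) m≤0)
            (y≥0 e)))
        }

    -- Twins of a fractional edge

    module _ {u : Edge n} (fu : Frac y u) where

      -- Tight sets around `u` share the vertex `lo u`, so they can be uncrossed and intersected one
      -- after another, beginning with V - r, which is tight by `full`.
      smallest-tight : inside others u ≡ true → ∀ L → ∃ λ D → TightSet y D × inside D u ≡ true ×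
        All (λ S → TightSet y S → inside S u ≡ true → D ⊆ S) L
      smallest-tight uV [] =
        others , tightSet others-r (lo u , ∧-trueˡ {others (lo u)} uV) full , uV , []
      smallest-tight uV (S ∷ L) with smallest-tight uV L | tight? y S | inside S u in Su
      ... | D , tD , Du , below | no ¬tS | _ = D , tD , Du , (λ tS _ → ⊥-elim (¬tS tS)) ∷ below
      ... | D , tD , Du , below | yes _ | false =
        D , tD , Du , (λ _ Su′ → ⊥-elim (true≢false Su′ Su)) ∷ below
      ... | D , tD , Du , below | yes tS | true =
        D ∩ S ,
        meet (uncross {D} {S} {lo u} tD tS (∧-trueˡ {D (lo u)} Du) (∧-trueˡ {S (lo u)} Su)) ,
        inside-∩ D S u Du Su ,
        (λ _ _ v h → ∧-trueʳ {D v} h) ∷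
        All.map (λ D⊆T tT Tu v h → D⊆T tT Tu v (∧-trueˡ {D v} h)) below

      module _ {D : VSet n} (tD : TightSet y D) where

        Piece : VSet n → Set
        Piece F = TightSet y F × F ⊆ D × inside F u ≡ false

        Covered : List (VSet n) → Edge n → Set
        Covered Fs e = Any (λ F → inside F e ≡ true) Fs

        -- T is merged with every member it meets.  The union of two meeting tight
        -- sets missing u still misses u, as otherwise u would run between them and
        -- have y u = 0.
        record Insertion (T : VSet n) (Fs : List (VSet n)) : Set where
          field
            result   : List (VSet n)
            pieces   : All Piece result
            disjoint : AllPairs Disjoint result
            new      : ∀ e → inside T e ≡ true → Covered result e
            old      : ∀ e → Covered Fs e → Covered result e
            away     : ∀ {X} → Disjoint X T → All (Disjoint X) Fs → All (Disjoint X) result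
        open Insertion

        insert : ∀ {T Fs} → Piece T → All Piece Fs → AllPairs Disjoint Fs → Insertion T Fs
        insert {T} {[]} pT [] [] = record
          { result = T ∷ [] ; pieces = pT ∷ [] ; disjoint = [] ∷ []
          ; new = λ e h → here h ; old = λ e () ; away = λ d _ → d ∷ [] }
        insert {T} {F ∷ Fs} pT@(tT , T⊆D , Tu) (pF@(tF , F⊆D , Fu) ∷ pFs) (dF ∷ dFs)
          with Fin.any? (λ v → T v ∧ F v Bool.≟ true)
        ... | no ¬meet = record
          { result = F ∷ result I
          ; pieces = pF ∷ pieces I
          -- F is disjoint from T and from the remaining members, hence by `away` from whatever T is
          -- merged into.
          ; disjoint = away I (λ v Fv Tv → ¬meet (v , ∧-true Tv Fv)) dF ∷ disjoint I
          ; new = λ e h → there (new I e h)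
          ; old = λ { e (here h) → here h ; e (there h) → there (old I e h) }
          ; away = λ { d (dX ∷ dXs) → dX ∷ away I d dXs }
          }
          where
          I : Insertion T Fs
          I = insert pT pFs dFs
        ... | yes (w , TFw) = record
          { result = result I
          ; pieces = pieces I
          ; disjoint = disjoint I
          ; new = λ e h → new I e (inside-⊆ {S = T} {T = T ∪ F} (λ v → ∨-trueˡ) e h)
          ; old = λ { e (here h) → new I e (inside-⊆ {S = F} {T = T ∪ F} (λ v → ∨-trueʳ {T v}) e h)
                    ; e (there h) → old I e h }
          ; away = λ { {X} dT (dX ∷ dXs) → away I (λ v Xv TFv → either {X} {v} (T v) refl dT dX Xv TFv) dXs }
          }
          where
          U : Uncrossed T F
          U = uncross {T} {F} {w} tT tF (∧-trueˡ {T w} TFw) (∧-trueʳ {T w} TFw)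
          either : ∀ {X v} b → T v ≡ b → Disjoint X T → Disjoint X F → X v ≡ true → b ∨ F v ≡ true → ⊥
          either {v = v} true  Tv dT dF Xv _  = dT v Xv Tv
          either {v = v} false _  dT dF Xv Fv = dF v Xv Fv
          below : ∀ {v} b → T v ≡ b → b ∨ F v ≡ true → D v ≡ true
          below {v} true  Tv _  = T⊆D v Tv
          below {v} false _  Fv = F⊆D v Fv
          I : Insertion (T ∪ F) Fs
          I = insert (join U , (λ v h → below {v} (T v) refl h) , no-edge U u (proj₁ fu) Tu Fu) pFs dFs

        -- A tight set S missing `u` enters as S ∩ D, which is tight by uncrossing whenever S meets
        -- D. Merging makes the members disjoint, so their integral masses add up.
        record Family (L : List (VSet n)) : Set where
          field
            members  : List (VSet n)
            pieces   : All Piece members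
            disjoint : AllPairs Disjoint members
            covers   : All (λ S → TightSet y S → inside S u ≡ false →
                         ∀ e → inside S e ≡ true → inside D e ≡ true → Covered members e) L
        open Family

        family : ∀ L → Family L
        family [] = record { members = [] ; pieces = [] ; disjoint = [] ; covers = [] }
        family (S ∷ L) = add (tight? y S) (inside S u) refl (Fin.any? (λ v → S v ∧ D v Bool.≟ true))
          where
          I : Family L
          I = family L
          keep : (TightSet y S → inside S u ≡ false →
                  ∀ e → inside S e ≡ true → inside D e ≡ true → Covered (members I) e) →
                 Family (S ∷ L)
          keep h = record { members = members I ; pieces = pieces I ; disjoint = disjoint I
                          ; covers = h ∷ covers I }
          add : Dec (TightSet y S) → ∀ b → inside S u ≡ b → Dec (∃ λ v → S v ∧ D v ≡ true) →
                Family (S ∷ L)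
          add (no ¬t) _     _  _ = keep (λ t → ⊥-elim (¬t t))
          add (yes _) true  Su _ = keep (λ _ Su′ → ⊥-elim (true≢false Su Su′))
          add (yes _) false _  (no ¬meet) = keep (λ _ _ e h k →
            ⊥-elim (¬meet (lo e , ∧-true (∧-trueˡ {S (lo e)} h) (∧-trueˡ {D (lo e)} k))))
          add (yes tS) false Su (yes (w , SDw)) = record
            { members = result K
            ; pieces = Insertion.pieces K
            ; disjoint = Insertion.disjoint K
            ; covers = (λ _ _ e h k → new K e (inside-∩ S D e h k)) ∷
                       All.map (λ c t Tu e h k → old K e (c t Tu e h k)) (covers I)
            }
            where
            T⊆S : S ∩ D ⊆ S
            T⊆S v h = ∧-trueˡ {S v} h
            Tu : inside (S ∩ D) u ≡ false
            Tu = ¬true⇒false (λ h → true≢false (inside-⊆ {S = S ∩ D} {T = S} T⊆S u h) Su)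
            K : Insertion (S ∩ D) (members I)
            K = insert
              (meet (uncross {S} {D} {w} tS tD (∧-trueˡ {S w} SDw) (∧-trueʳ {S w} SDw)) ,
               (λ v h → ∧-trueʳ {S v} h) , Tu)
              (pieces I) (disjoint I)

        covered : List (VSet n) → Edge n → Bool
        covered []       e = false
        covered (F ∷ Fs) e = inside F e ∨ covered Fs e

        Covered⇒covered : ∀ {Fs e} → Covered Fs e → covered Fs e ≡ true
        Covered⇒covered (here h)  = ∨-trueˡ h
        Covered⇒covered {F ∷ Fs} {e} (there h) = ∨-trueʳ {inside F e} (Covered⇒covered h)

        covered-case : ∀ {P : Set} F Fs {e} → covered (F ∷ Fs) e ≡ true →
          (inside F e ≡ true → P) → (covered Fs e ≡ true → P) → P
        covered-case F Fs {e} h f g with inside F e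
        ... | true  = f refl
        ... | false = g h

        mass-int : ∀ {S} → TightSet y S → IsInt (mass y S)
        mass-int {S} t = subst IsInt
          (trans (cong (_- 1ℚ) (sym (count t))) (solve 1 (λ m → m :+ con 1ℚ :- con 1ℚ := m) refl (mass y S)))
          (int-+ (size-int S) (int-neg (int-ind true)))

        covered-disjoint : ∀ {X} Fs → All (Disjoint X) Fs → ∀ {e} → inside X e ≡ true →
                           covered Fs e ≡ true → ⊥
        covered-disjoint {X} (F ∷ Fs) (d ∷ ds) {e} Xe h = covered-case F Fs {e} h
          (λ Fe → d (lo e) (∧-trueˡ {X (lo e)} Xe) (∧-trueˡ {F (lo e)} Fe))
          (covered-disjoint Fs ds {e} Xe)

        covered-int : ∀ {Fs} → All Piece Fs → AllPairs Disjoint Fs → IsInt (inner (covered Fs) y)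
        covered-int [] [] = int-sum (allEdges n) (λ e → int-ind-0 (y e))
          where
          int-ind-0 : ∀ q → IsInt (0ℚ * q)
          int-ind-0 q = subst IsInt (sym (ℚ.*-zeroˡ q)) (int-ind false)
        covered-int {F ∷ Fs} (pF ∷ pFs) (d ∷ ds) = subst IsInt
          (inner-+ (inside F) (covered Fs) (covered (F ∷ Fs)) y (λ e → bool (inside F e) (covered Fs e) (covered-disjoint Fs d {e})))
          (int-+ (mass-int (proj₁ pF)) (covered-int pFs ds))
          where
          bool : ∀ a b → (a ≡ true → b ≡ true → ⊥) → ind a + ind b ≡ ind (a ∨ b)
          bool true  true  h = ⊥-elim (h refl refl)
          bool true  false h = refl
          bool false b     h = ℚ.+-identityˡ (ind b)

        covered-⊆ : ∀ {Fs} → All Piece Fs → ∀ {e} → covered Fs e ≡ true → inside D e ≡ true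
        covered-⊆ {F ∷ Fs} ((_ , F⊆D , _) ∷ ps) {e} h = covered-case F Fs {e} h
          (inside-⊆ {S = F} {T = D} F⊆D e) (covered-⊆ ps {e})

        covered-u : ∀ {Fs} → All Piece Fs → covered Fs u ≡ false
        covered-u []                              = refl
        covered-u {F ∷ Fs} ((_ , _ , Fu) ∷ ps) = cong₂ _∨_ Fu (covered-u ps)

        -- For the smallest tight D around `u` and its full family, these edges cannot be told apart
        -- from `u` by tight sets: one containing `u` includes all of D, and one missing `u` has its
        -- edges in D covered.
        atom : List (VSet n) → Edge n → Bool
        atom Fs e = inside D e ∧ not (covered Fs e)

        atom-int : ∀ {Fs} → All Piece Fs → AllPairs Disjoint Fs → IsInt (inner (atom Fs) y)
        atom-int {Fs} ps ds = subst IsInt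
          (trans (cong (_- inner (covered Fs) y) (sym total))
                 (solve 2 (λ a b → a :+ b :- b := a) refl (inner (atom Fs) y) (inner (covered Fs) y)))
          (int-+ (mass-int tD) (int-neg (covered-int ps ds)))
          where
          bool : ∀ a b → (b ≡ true → a ≡ true) → ind (a ∧ not b) + ind b ≡ ind a
          bool true  true  h = refl
          bool true  false h = refl
          bool false false h = refl
          bool false true  h with () ← h refl
          total : inner (atom Fs) y + inner (covered Fs) y ≡ mass y D
          total = inner-+ (atom Fs) (covered Fs) (inside D) y (λ e → bool (inside D e) (covered Fs e) (covered-⊆ ps {e}))

      -- `rooted` serves the degree equation at `r` and, since an edge is inside V - r exactly if it
      -- misses `r`, the equation `full` as well; both are tight at every point.
      record Twin : Set where
        field
          twin     : Edge n
          twin≢u   : twin ≢ u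
          frac     : Frac y twin
          rooted   : incident r twin ≡ incident r u
          together : All (λ S → TightSet y S → inside S twin ≡ inside S u) (subsets n)

      -- Tight sets avoid `r`, so no edge at `r` lies inside any of them. The integral weight 2 of
      -- δ(r) plays the part of the atom.
      twin-at-root : inside others u ≡ false → Twin
      twin-at-root uV = build (another-fractional (edges n) y≥0 y≤1 (incident r)
        (subst IsInt (sym root) (int-nat 2)) u-inc fu)
        where
        u-inc : incident r u ≡ true
        u-inc = trans (incident-others u) (cong not uV)
        outside : ∀ {S e} → TightSet y S → incident r e ≡ true → inside S e ≡ false
        outside {S} {e} t inc = ¬true⇒false (λ h → true≢false inc (inside⇒¬incident {S} {e} (avoids t) h))
        build : (∃ λ v → v ≢ u × incident r v ≡ true × Frac y v) → Twin
        build (v , v≢u , v-inc , fv) = record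
          { twin = v ; twin≢u = v≢u ; frac = fv ; rooted = trans v-inc (sym u-inc)
          ; together = All.tabulate (λ {S} _ t → trans (outside {S} {v} t v-inc) (sym (outside {S} {u} t u-inc)))
          }

      twin-in-tree : inside others u ≡ true → Twin
      twin-in-tree uV = inD (smallest-tight uV (subsets n))
        where
        inD : (∃ λ D → TightSet y D × inside D u ≡ true ×
                 All (λ S → TightSet y S → inside S u ≡ true → D ⊆ S) (subsets n)) → Twin
        inD (D , tD , Du , below) = build (another-fractional (edges n) y≥0 y≤1 (atom tD (members 𝓕))
            (atom-int tD (pieces 𝓕) (disjoint 𝓕)) {u}
            (∧-true Du (cong not (covered-u tD (pieces 𝓕)))) fu)
          where
          open Family
          𝓕 : Family tD (subsets n)
          𝓕 = family tD (subsets n)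
          build : (∃ λ v → v ≢ u × atom tD (members 𝓕) v ≡ true × Frac y v) → Twin
          build (v , v≢u , atom-v , fv) = record
            { twin = v ; twin≢u = v≢u ; frac = fv
            ; rooted = trans (inside⇒¬incident {D} {v} (avoids tD) Dv)
                             (sym (inside⇒¬incident {D} {u} (avoids tD) Du))
            ; together = All.zipWith (λ {S} (b , c) t → same S (inside S u) refl b c t) (below , covers 𝓕)
            }
            where
            Dv : inside D v ≡ true
            Dv = ∧-trueˡ {inside D v} atom-v
            uncovered : covered tD (members 𝓕) v ≡ true → ⊥
            uncovered h = true≢false (∧-trueʳ {inside D v} atom-v) (cong not h)
            same : ∀ S b → inside S u ≡ b →
              (TightSet y S → inside S u ≡ true → D ⊆ S) →
              (TightSet y S → inside S u ≡ false → ∀ e → inside S e ≡ true → inside D e ≡ true →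
                 Covered tD (members 𝓕) e) →
              TightSet y S → inside S v ≡ inside S u
            same S true  Su b c t = trans (inside-⊆ {S = D} {T = S} (b t Su) v Dv) (sym Su)
            same S false Su b c t = trans
              (¬true⇒false (λ Sv → uncovered (Covered⇒covered tD (c t Su v Sv Dv)))) (sym Su)

      twin-of : Twin
      twin-of with inside others u in uV
      ... | true  = twin-in-tree uV
      ... | false = twin-at-root uV

-- The constraints of the 1-tree polytope

double-≤ : ∀ {p q} → p + p ≤ℚ q + q → p ≤ℚ q
double-≤ {p} {q} h with p ℚ.≤? q
... | yes p≤q = p≤q
... | no p≰q  = ⊥-elim (ℚ.<-irrefl refl (ℚ.<-≤-trans (ℚ.+-mono-< (ℚ.≰⇒> p≰q) (ℚ.≰⇒> p≰q)) h))

double-≡ : ∀ {p q} → p + p ≡ q + q → p ≡ q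
double-≡ eq = ℚ.≤-antisym (double-≤ (ℚ.≤-reflexive eq)) (double-≤ (ℚ.≤-reflexive (sym eq)))

sum-fin-at : ∀ {n} (f : Fin n → ℚ) v → (∀ w → w ≢ v → f w ≡ 0ℚ) → sum (allFin n) f ≡ f v
sum-fin-at f v z = sum-tabulate-at (λ w → w) f v z

module _ {n : ℕ} where

  single-refl : ∀ (v : Fin n) → single v v ≡ true
  single-refl v with v Fin.≟ v
  ... | yes _ = refl
  ... | no ¬p = ⊥-elim (¬p refl)

  single-≢ : ∀ {v w : Fin n} → w ≢ v → single v w ≡ false
  single-≢ {v} {w} w≢v with w Fin.≟ v
  ... | yes p = ⊥-elim (w≢v p)
  ... | no _ = refl

  single-≡ : ∀ {v w : Fin n} → single v w ≡ true → w ≡ v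
  single-≡ {v} {w} h with w Fin.≟ v
  ... | yes p = p

  cut-inner : ∀ x (S : VSet n) → cut x S ≡ inner (crosses S) x
  cut-inner x S = sum-cong (allEdges n) (λ e → if-ind (crosses S e) (x e))
    where
    if-ind : ∀ b q → (if b then q else 0ℚ) ≡ ind b * q
    if-ind true  q = sym (ℚ.*-identityˡ q)
    if-ind false q = sym (ℚ.*-zeroˡ q)

  endpoints : ∀ (S : VSet n) e →
    sum (allFin n) (λ v → ind (S v) * ind (incident v e)) ≡ ind (S (lo e)) + ind (S (hi e))
  endpoints S e = begin
    sum (allFin n) (λ v → ind (S v) * ind (incident v e))
      ≡⟨ sum-cong (allFin n) split ⟩
    sum (allFin n) (λ v → ind (S v) * ind (single v (lo e)) + ind (S v) * ind (single v (hi e)))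
      ≡⟨ sum-+ (allFin n) _ _ ⟩
    sum (allFin n) (λ v → ind (S v) * ind (single v (lo e))) +
    sum (allFin n) (λ v → ind (S v) * ind (single v (hi e)))
      ≡⟨ cong₂ _+_ (pick (lo e)) (pick (hi e)) ⟩
    ind (S (lo e)) + ind (S (hi e)) ∎
    where
    split : ∀ v → ind (S v) * ind (incident v e) ≡
                  ind (S v) * ind (single v (lo e)) + ind (S v) * ind (single v (hi e))
    split v with lo e Fin.≟ v | hi e Fin.≟ v
    ... | yes p | yes q = ⊥-elim (lo≢hi e (trans p (sym q)))
    ... | yes _ | no _  = solve 1 (λ s → s :* con 1ℚ := s :* con 1ℚ :+ s :* con 0ℚ) refl (ind (S v))
    ... | no _  | yes _ = solve 1 (λ s → s :* con 1ℚ := s :* con 0ℚ :+ s :* con 1ℚ) refl (ind (S v))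
    ... | no _  | no _  = solve 1 (λ s → s :* con 0ℚ := s :* con 0ℚ :+ s :* con 0ℚ) refl (ind (S v))
    pick : ∀ w → sum (allFin n) (λ v → ind (S v) * ind (single v w)) ≡ ind (S w)
    pick w = trans
      (sum-fin-at _ w (λ v v≢w → trans (cong (λ b → ind (S v) * ind b) (single-≢ (λ eq → v≢w (sym eq))))
                                       (ℚ.*-zeroʳ (ind (S v)))))
      (trans (cong (λ b → ind (S w) * ind b) (single-refl w)) (ℚ.*-identityʳ (ind (S w))))

  -- Summing degrees over S counts an edge inside S twice and an edge leaving S once.
  handshake : ∀ x (S : VSet n) →
    sum (allFin n) (λ v → ind (S v) * inner (incident v) x) ≡ mass x S + mass x S + inner (crosses S) x
  handshake x S = begin
    sum (allFin n) (λ v → ind (S v) * inner (incident v) x)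
      ≡⟨ sum-cong (allFin n) (λ v → sum-* (allEdges n) (ind (S v)) (λ e → ind (incident v e) * x e)) ⟨
    sum (allFin n) (λ v → sum (allEdges n) (λ e → ind (S v) * (ind (incident v e) * x e)))
      ≡⟨ sum-swap (allFin n) (allEdges n) (λ v e → ind (S v) * (ind (incident v e) * x e)) ⟩
    sum (allEdges n) (λ e → sum (allFin n) (λ v → ind (S v) * (ind (incident v e) * x e)))
      ≡⟨ sum-cong (allEdges n) collect ⟩
    dot (allEdges n) (λ e → ind (inside S e) + ind (inside S e) + ind (crosses S e)) x
      ≡⟨ dot-+ˡ (allEdges n) (λ e → ind (inside S e) + ind (inside S e)) (λ e → ind (crosses S e)) x ⟩
    dot (allEdges n) (λ e → ind (inside S e) + ind (inside S e)) x + inner (crosses S) x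
      ≡⟨ cong (_+ inner (crosses S) x) (dot-+ˡ (allEdges n) (λ e → ind (inside S e)) (λ e → ind (inside S e)) x) ⟩
    mass x S + mass x S + inner (crosses S) x ∎
    where
    bool : ∀ a b → ind a + ind b ≡ ind (a ∧ b) + ind (a ∧ b) + ind (a xor b)
    bool true  true  = refl
    bool true  false = refl
    bool false true  = refl
    bool false false = refl
    collect : ∀ e → sum (allFin n) (λ v → ind (S v) * (ind (incident v e) * x e)) ≡
                    (ind (inside S e) + ind (inside S e) + ind (crosses S e)) * x e
    collect e = begin
      sum (allFin n) (λ v → ind (S v) * (ind (incident v e) * x e))
        ≡⟨ sum-cong (allFin n) (λ v → solve 3 (λ a b c → a :* (b :* c) := c :* (a :* b)) refl
             (ind (S v)) (ind (incident v e)) (x e)) ⟩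
      sum (allFin n) (λ v → x e * (ind (S v) * ind (incident v e)))
        ≡⟨ sum-* (allFin n) (x e) _ ⟩
      x e * sum (allFin n) (λ v → ind (S v) * ind (incident v e))
        ≡⟨ cong (x e *_) (trans (endpoints S e) (bool (S (lo e)) (S (hi e)))) ⟩
      x e * (ind (inside S e) + ind (inside S e) + ind (crosses S e))
        ≡⟨ ℚ.*-comm (x e) _ ⟩
      (ind (inside S e) + ind (inside S e) + ind (crosses S e)) * x e ∎

module _ {n : ℕ} (r : Fin n) where

  -- With all degrees 2, handshaking reads 2x(E[S]) + x(δ(S)) = 2|S|. A set avoiding `r` is proper,
  -- so its cut is at least 2, which is `sparse`; the cut of V - r is δ(r), of weight exactly 2,
  -- which is `full`.
  subtour⇒forest : ∀ {x} → InSubtour n x → Forest r x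
  subtour⇒forest {x} (degree , cuts , bounds) = record
    { y≥0 = λ e → proj₁ (bounds e)
    ; y≤1 = λ e → proj₂ (bounds e)
    ; sparse = λ S Sr member → double-≤ (≤-by
        (diff≥0 (subst (2ℚ ≤ℚ_) (cut-inner x S) (cuts S member (r , Sr))))
        (trans (algebra (mass x S) (inner (crosses S) x)) (halves S)))
    ; full = double-≡ (begin
        mass x V + 1ℚ + (mass x V + 1ℚ)
          ≡⟨ solve 1 (λ m → m :+ con 1ℚ :+ (m :+ con 1ℚ) := m :+ m :+ con 2ℚ) refl (mass x V) ⟩
        mass x V + mass x V + 2ℚ
          ≡⟨ cong (mass x V + mass x V +_) (trans (inner-cong x co-cut) (degree-inner r)) ⟨
        mass x V + mass x V + inner (crosses V) x
          ≡⟨ halves V ⟩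
        size V + size V ∎)
    ; root = degree-inner r
    }
    where
    V : VSet n
    V = others r
    degree-inner : ∀ v → inner (incident v) x ≡ 2ℚ
    degree-inner v = trans (sym (cut-inner x (single v))) (degree v)
    halves : ∀ S → mass x S + mass x S + inner (crosses S) x ≡ size S + size S
    halves S = begin
      mass x S + mass x S + inner (crosses S) x
        ≡⟨ handshake x S ⟨
      sum (allFin n) (λ v → ind (S v) * inner (incident v) x)
        ≡⟨ sum-cong (allFin n) (λ v → trans (cong (ind (S v) *_) (degree-inner v))
             (solve 1 (λ s → s :* con 2ℚ := s :+ s) refl (ind (S v)))) ⟩
      sum (allFin n) (λ v → ind (S v) + ind (S v))
        ≡⟨ sum-+ (allFin n) _ _ ⟩
      size S + size S ∎
    algebra : ∀ m c → m + 1ℚ + (m + 1ℚ) + (c - 2ℚ) ≡ m + m + c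
    algebra = solve 2 (λ m c → m :+ con 1ℚ :+ (m :+ con 1ℚ) :+ (c :- con 2ℚ) := m :+ m :+ c) refl
    co-cut : ∀ e → crosses V e ≡ incident r e
    co-cut e = bool (single r (lo e)) (single r (hi e))
      where
      bool : ∀ a b → not a xor not b ≡ a xor b
      bool true  true  = refl
      bool true  false = refl
      bool false true  = refl
      bool false false = refl

  setC : VSet n → Constraint (Edge n)
  setC S = (λ e → ind (inside S e)) , size S - 1ℚ

  -- Equations are listed as a constraint and its opposite, and nonnegativity as the opposite of the
  -- upper bound 0.
  opposite : Constraint (Edge n) → Constraint (Edge n)
  opposite (a , b) = (λ e → - 1ℚ * a e) , - b

  rootC : Constraint (Edge n)
  rootC = (λ e → ind (incident r e)) , 2ℚ

  upperC : Edge n → ℚ → Constraint (Edge n)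
  upperC e b = basis (edges n) e , b

  Valid : VSet n → Set
  Valid S = S r ≡ false × ∃ λ v → S v ≡ true

  valid? : ∀ S → Dec (Valid S)
  valid? S = (S r Bool.≟ false) ×-dec Fin.any? (λ v → S v Bool.≟ true)

  setCs boundCs constraints : List (Constraint (Edge n))
  setCs = map setC (filter valid? (subsets n))
  boundCs = map (λ e → upperC e 1ℚ) (allEdges n) ++ map (λ e → opposite (upperC e 0ℚ)) (allEdges n)
  constraints = setCs ++ setC (others r) ∷ opposite (setC (others r)) ∷ rootC ∷ opposite rootC ∷ boundCs

  module _ {P : Constraint (Edge n) → Set} where

    all-constraints : (∀ S → S ∈ subsets n → Valid S → P (setC S)) → P (setC (others r)) → P (opposite (setC (others r))) →
      P rootC → P (opposite rootC) → (∀ e → P (upperC e 1ℚ)) → (∀ e → P (opposite (upperC e 0ℚ))) →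
      All P constraints
    all-constraints sets full≤ full≥ root≤ root≥ upper lower = Allₚ.++⁺
      (Allₚ.map⁺ (All.tabulate (λ {S} S∈ → sets S (proj₁ (∈-filter⁻ valid? S∈)) (proj₂ (∈-filter⁻ valid? {xs = subsets n} S∈)))))
      (full≤ ∷ full≥ ∷ root≤ ∷ root≥ ∷ Allₚ.++⁺
        (Allₚ.map⁺ (All.tabulate {xs = allEdges n} (λ {e} _ → upper e)))
        (Allₚ.map⁺ (All.tabulate {xs = allEdges n} (λ {e} _ → lower e))))

  setC∈ : ∀ {S} → S ∈ subsets n → Valid S → setC S ∈ constraints
  setC∈ S∈ v = ∈-++⁺ˡ (∈-map⁺ setC (∈-filter⁺ valid? S∈ v))

  full≤∈ : setC (others r) ∈ constraints
  full≤∈ = ∈-++⁺ʳ setCs (here refl)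

  full≥∈ : opposite (setC (others r)) ∈ constraints
  full≥∈ = ∈-++⁺ʳ setCs (there (here refl))

  root≤∈ : rootC ∈ constraints
  root≤∈ = ∈-++⁺ʳ setCs (there (there (here refl)))

  root≥∈ : opposite rootC ∈ constraints
  root≥∈ = ∈-++⁺ʳ setCs (there (there (there (here refl))))

  upper∈ : ∀ e → upperC e 1ℚ ∈ constraints
  upper∈ e = ∈-++⁺ʳ setCs (there (there (there (there
    (∈-++⁺ˡ (∈-map⁺ (λ e → upperC e 1ℚ) (Enumeration.complete (edges n) e)))))))

  lower∈ : ∀ e → opposite (upperC e 0ℚ) ∈ constraints
  lower∈ e = ∈-++⁺ʳ setCs (there (there (there (there
    (∈-++⁺ʳ (map (λ e → upperC e 1ℚ) (allEdges n))
      (∈-map⁺ (λ e → opposite (upperC e 0ℚ)) (Enumeration.complete (edges n) e)))))))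

  slack-opposite : ∀ y c → slack (allEdges n) y (opposite c) ≡ - slack (allEdges n) y c
  slack-opposite y (a , b) = trans
    (cong (λ q → - b - q) (dot-*ˡ (allEdges n) (- 1ℚ) a y))
    (solve 2 (λ b q → :- b :- con (- 1ℚ) :* q := :- (b :- q)) refl b (dot (allEdges n) a y))

  slack-set : ∀ y S → slack (allEdges n) y (setC S) ≡ size S - (mass y S + 1ℚ)
  slack-set y S = solve 2 (λ s m → s :- con 1ℚ :- m := s :- (m :+ con 1ℚ)) refl (size S) (mass y S)

  slack-upper : ∀ y e b → slack (allEdges n) y (upperC e b) ≡ b - y e
  slack-upper y e b = cong (λ q → b - q) (dot-basisˡ (edges n) e y)

  slack-lower : ∀ y e → slack (allEdges n) y (opposite (upperC e 0ℚ)) ≡ y e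
  slack-lower y e = trans (slack-opposite y (upperC e 0ℚ)) (trans (cong -_ (slack-upper y e 0ℚ))
    (solve 1 (λ q → :- (con 0ℚ :- q) := q) refl (y e)))

  zero-slack : ∀ {p q} → p ≡ q → q - p ≡ 0ℚ
  zero-slack {p} refl = ℚ.+-inverseʳ p

  slack-zero : ∀ {p q} → q - p ≡ 0ℚ → p ≡ q
  slack-zero {p} {q} eq = trans (solve 2 (λ p q → p := q :- (q :- p)) refl p q)
    (trans (cong (λ z → q - z) eq) (solve 1 (λ q → q :- con 0ℚ := q) refl q))

  slack≥0 : ∀ {p q} → 0ℚ ≤ℚ q - p → p ≤ℚ q
  slack≥0 {p} {q} h = ≤-by h (solve 2 (λ p q → p :+ (q :- p) := q) refl p q)

  slack-both : ∀ {p q} → 0ℚ ≤ℚ q - p → 0ℚ ≤ℚ - (q - p) → p ≡ q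
  slack-both {p} {q} h k = ℚ.≤-antisym (slack≥0 h)
    (≤-by k (solve 2 (λ p q → q :+ :- (q :- p) := p) refl p q))

  Feas : (Edge n → ℚ) → Set
  Feas = Feasible (allEdges n) constraints

  forest⇒feasible : ∀ {y} → Forest r y → Feas y
  forest⇒feasible {y} forest = all-constraints
    (λ S _ (Sr , mem) → subst (0ℚ ≤ℚ_) (sym (slack-set y S)) (diff≥0 (sparse S Sr mem)))
    (ℚ.≤-reflexive (sym (trans (slack-set y (others r)) (zero-slack full))))
    (ℚ.≤-reflexive (sym (trans (slack-opposite y (setC (others r)))
      (cong -_ (trans (slack-set y (others r)) (zero-slack full))))))
    (ℚ.≤-reflexive (sym (zero-slack root)))
    (ℚ.≤-reflexive (sym (trans (slack-opposite y rootC) (cong -_ (zero-slack root)))))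
    (λ e → subst (0ℚ ≤ℚ_) (sym (slack-upper y e 1ℚ)) (diff≥0 (y≤1 e)))
    (λ e → subst (0ℚ ≤ℚ_) (sym (slack-lower y e)) (y≥0 e))
    where open Forest forest

  feasible⇒forest : ∀ {y} → Feas y → Forest r y
  feasible⇒forest {y} feas = record
    { y≥0 = λ e → subst (0ℚ ≤ℚ_) (slack-lower y e) (look (lower∈ e))
    ; y≤1 = λ e → slack≥0 (subst (0ℚ ≤ℚ_) (slack-upper y e 1ℚ) (look (upper∈ e)))
    ; sparse = λ S Sr mem → sparse′ S Sr mem (find (subsets-complete S))
    ; full = slack-both
        (subst (0ℚ ≤ℚ_) (slack-set y V) (look full≤∈))
        (subst (0ℚ ≤ℚ_) (trans (slack-opposite y (setC V)) (cong -_ (slack-set y V))) (look full≥∈))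
    ; root = slack-both (look root≤∈) (subst (0ℚ ≤ℚ_) (slack-opposite y rootC) (look root≥∈))
    }
    where
    V : VSet n
    V = others r
    look : ∀ {c} → c ∈ constraints → 0ℚ ≤ℚ slack (allEdges n) y c
    look c∈ = All.lookup feas c∈
    sparse′ : ∀ S → S r ≡ false → (∃ λ v → S v ≡ true) →
      (∃ λ S′ → S′ ∈ subsets n × (∀ v → S′ v ≡ S v)) → mass y S + 1ℚ ≤ℚ size S
    sparse′ S Sr (v , Sv) (S′ , S′∈ , eq) = subst₂ _≤ℚ_
      (cong (_+ 1ℚ) (mass-cong y eq)) (size-cong eq)
      (slack≥0 (subst (0ℚ ≤ℚ_) (slack-set y S′)
        (look (setC∈ S′∈ (trans (eq r) Sr , v , trans (eq v) Sv)))))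

-- Pairs of half-edges

sum-↭ : ∀ {A : Set} {xs ys : List A} (f : A → ℚ) → xs ↭ ys → sum xs f ≡ sum ys f
sum-↭ f Perm.refl          = refl
sum-↭ f (Perm.prep a p)    = cong (f a +_) (sum-↭ f p)
sum-↭ {ys = _ ∷ _ ∷ ys} f (Perm.swap a b p) = trans
  (cong (λ z → f a + (f b + z)) (sum-↭ f p))
  (solve 3 (λ s t u → s :+ (t :+ u) := t :+ (s :+ u)) refl (f a) (f b) (sum ys f))
sum-↭ f (Perm.trans p q)   = trans (sum-↭ f p) (sum-↭ f q)

sum-filterB-≤ : ∀ {A : Set} (p : A → Bool) {f : A → ℚ} → (∀ a → 0ℚ ≤ℚ f a) → ∀ L →
                sum (filterB p L) f ≤ℚ sum L f
sum-filterB-≤ p f≥0 []      = ℚ.≤-refl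
sum-filterB-≤ p {f} f≥0 (a ∷ L) with p a
... | true  = ℚ.+-monoʳ-≤ (f a) (sum-filterB-≤ p f≥0 L)
... | false = ℚ.≤-trans (sum-filterB-≤ p f≥0 L) (≤-by (f≥0 a) (ℚ.+-comm (sum L f) (f a)))

∈-filterB⁺ : ∀ {A : Set} (p : A → Bool) {a : A} {L} → a ∈ L → p a ≡ true → a ∈ filterB p L
∈-filterB⁺ p {a} (here refl) pa rewrite pa = here refl
∈-filterB⁺ p {a} {b ∷ L} (there a∈) pa with p b
... | true  = there (∈-filterB⁺ p a∈ pa)
... | false = ∈-filterB⁺ p a∈ pa

∈-filterB⁻ : ∀ {A : Set} (p : A → Bool) {a : A} L → a ∈ filterB p L → p a ≡ true
∈-filterB⁻ p (b ∷ L) a∈ with p b in pb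
∈-filterB⁻ p (b ∷ L) (here refl) | true = pb
∈-filterB⁻ p (b ∷ L) (there a∈)  | true = ∈-filterB⁻ p L a∈
... | false = ∈-filterB⁻ p L a∈

∈-flattenˡ : ∀ {A : Set} {p q : A} {P} → (p , q) ∈ P → p ∈ flatten P
∈-flattenˡ (here refl) = here refl
∈-flattenˡ (there pq)  = there (there (∈-flattenˡ pq))

∈-flattenʳ : ∀ {A : Set} {p q : A} {P} → (p , q) ∈ P → q ∈ flatten P
∈-flattenʳ (here refl) = there (here refl)
∈-flattenʳ (there pq)  = there (there (∈-flattenʳ pq))

∈-flatten⁻ : ∀ {A : Set} {a : A} P → a ∈ flatten P → ∃ λ b → (a , b) ∈ P ⊎ (b , a) ∈ P
∈-flatten⁻ ((p , q) ∷ P) (here refl)         = q , inj₁ (here refl)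
∈-flatten⁻ ((p , q) ∷ P) (there (here refl)) = p , inj₂ (here refl)
∈-flatten⁻ ((p , q) ∷ P) (there (there a∈)) with ∈-flatten⁻ P a∈
... | b , inj₁ ab = b , inj₁ (there ab)
... | b , inj₂ ba = b , inj₂ (there ba)

pair-≢ : ∀ {A : Set} {P : List (A × A)} {p q} → Unique (flatten P) → (p , q) ∈ P → p ≢ q
pair-≢ ((p≢q ∷ _) ∷ _) (here refl) = p≢q
pair-≢ (_ ∷ _ ∷ u) (there pq)      = pair-≢ u pq

module _ {A : Set} (E : Enumeration A) where
  open Enumeration E

  basis≥0 : ∀ e a → 0ℚ ≤ℚ basis E e a
  basis≥0 e a = ind≥0 ⌊ a ≟ᴬ e ⌋

  -- Summing the unit vector at e over a list counts the occurrences of e. These counts survive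
  -- permutation and do not grow under filtering, so the enumeration of all edges passes uniqueness
  -- on to the paired edges.
  sum-basis⇒unique : ∀ L → (∀ e → sum L (basis E e) ≤ℚ 1ℚ) → Unique L
  sum-basis⇒unique [] h = []
  sum-basis⇒unique (a ∷ L) h =
    All.tabulate (λ {b} b∈L a≡b → ℚ.<-irrefl refl (ℚ.<-≤-trans 1<2 (ℚ.≤-trans (≤-by (diff≥0
      (term≤sum (basis≥0 a) b∈L)) (step a≡b)) (h a)))) ∷
    sum-basis⇒unique L (λ e → ℚ.≤-trans (≤-by (basis≥0 e a) (ℚ.+-comm (sum L (basis E e)) (basis E e a))) (h e))
    where
    1<2 : 1ℚ <ℚ 2ℚ
    1<2 = ℚ.+-monoʳ-< 1ℚ (ℚ.positive⁻¹ 1ℚ)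
    step : ∀ {b} → a ≡ b → 2ℚ + (sum L (basis E a) - basis E a b) ≡ basis E a a + sum L (basis E a)
    step refl rewrite basis-≡ E {a} {a} refl =
      solve 1 (λ s → con 2ℚ :+ (s :- con 1ℚ) := con 1ℚ :+ s) refl (sum L (basis E a))

  -- An element outside all pairs is its own mate; fractional edges always lie in a pair.
  mate : List (A × A) → A → A
  mate []            e = e
  mate ((p , q) ∷ P) e with e ≟ᴬ p | e ≟ᴬ q
  ... | yes _ | _     = q
  ... | no _  | yes _ = p
  ... | no _  | no _  = mate P e

  mateˡ : ∀ {P : List (A × A)} {p q} → Unique (flatten P) → (p , q) ∈ P → mate P p ≡ q
  mateˡ {(p , q) ∷ P} u (here refl) with p ≟ᴬ p
  ... | yes _ = refl
  ... | no ¬p = ⊥-elim (¬p refl)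
  mateˡ {(s , t) ∷ P} {p} ((_ ∷ s∉) ∷ t∉ ∷ u) (there pq) with p ≟ᴬ s | p ≟ᴬ t
  ... | yes refl | _        = ⊥-elim (All.lookup s∉ (∈-flattenˡ pq) refl)
  ... | no _     | yes refl = ⊥-elim (All.lookup t∉ (∈-flattenˡ pq) refl)
  ... | no _     | no _     = mateˡ u pq

  mateʳ : ∀ {P : List (A × A)} {p q} → Unique (flatten P) → (p , q) ∈ P → mate P q ≡ p
  mateʳ {(p , q) ∷ P} ((p≢q ∷ _) ∷ _) (here refl) with q ≟ᴬ p | q ≟ᴬ q
  ... | yes q≡p | _     = q≡p
  ... | no _    | yes _ = refl
  ... | no _    | no ¬q = ⊥-elim (¬q refl)
  mateʳ {(s , t) ∷ P} {q = q} ((_ ∷ s∉) ∷ t∉ ∷ u) (there pq) with q ≟ᴬ s | q ≟ᴬ t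
  ... | yes refl | _        = ⊥-elim (All.lookup s∉ (∈-flattenʳ pq) refl)
  ... | no _     | yes refl = ⊥-elim (All.lookup t∉ (∈-flattenʳ pq) refl)
  ... | no _     | no _     = mateʳ u pq

-- Directions from alternating cycles of edges

module _ {n : ℕ} (r : Fin n) {x : Edge n → ℚ} (half : HalfInteger x)
         {P : List (Edge n × Edge n)} (part : PairPartition x P) where

  isHalf⁺ : ∀ {e} → x e ≡ ½ → isHalf x e ≡ true
  isHalf⁺ {e} eq with x e ℚ.≟ ½
  ... | yes _ = refl
  ... | no ¬h = ⊥-elim (¬h eq)

  isHalf⁻ : ∀ {e} → isHalf x e ≡ true → x e ≡ ½
  isHalf⁻ {e} h with x e ℚ.≟ ½
  ... | yes eq = eq

  paired⇒half : ∀ {e} → e ∈ flatten P → x e ≡ ½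
  paired⇒half e∈ = isHalf⁻ (∈-filterB⁻ (isHalf x) (allEdges n) (∈-resp-↭ part e∈))

  half⇒paired : ∀ {e} → x e ≡ ½ → e ∈ flatten P
  half⇒paired {e} eq = ∈-resp-↭ (↭-sym part)
    (∈-filterB⁺ (isHalf x) (Enumeration.complete (edges n) e) (isHalf⁺ eq))

  unique : Unique (flatten P)
  unique = sum-basis⇒unique (edges n) (flatten P) (λ e → subst (_≤ℚ 1ℚ)
    (sym (sum-↭ (basis (edges n) e) part))
    (ℚ.≤-trans (sum-filterB-≤ (isHalf x) (basis≥0 (edges n) e) (allEdges n))
      (ℚ.≤-reflexive (trans (Enumeration.sum-at (edges n) (basis (edges n) e) e (λ b b≢e → basis-≢ (edges n) b≢e))
                            (basis-≡ (edges n) {e} {e} refl)))))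

  σ : Edge n → Edge n
  σ = mate (edges n) P

  -- These equations hold along the whole line through a point, so they stay apart from the
  -- constraints that may block a step.
  record Inv (y : Edge n → ℚ) : Set where
    field
      pairs : ∀ {p q} → (p , q) ∈ P → y p + y q ≡ 1ℚ
      fixed : ∀ {e} → x e ≢ ½ → y e ≡ x e
  open Inv

  inv-x : Inv x
  inv-x = record
    { pairs = λ pq → cong₂ _+_ (paired⇒half (∈-flattenˡ pq)) (paired⇒half (∈-flattenʳ pq))
    ; fixed = λ _ → refl }

  inv-resp : ∀ {y z} → (∀ e → y e ≡ z e) → Inv y → Inv z
  inv-resp eq inv = record
    { pairs = λ {p} {q} pq → trans (sym (cong₂ _+_ (eq p) (eq q))) (pairs inv pq)
    ; fixed = λ {e} h → trans (sym (eq e)) (fixed inv h) }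

  -- Half-integrality at work: off the ½-edges `y` keeps the value 0 or 1 of `x`, so every
  -- fractional edge is paired.
  fixed⇒¬frac : ∀ {y e} → Inv y → x e ≢ ½ → ¬ Frac y e
  fixed⇒¬frac {y} {e} inv h (y≢0 , y≢1) with half e
  ... | inj₁ x≡0        = y≢0 (trans (fixed inv h) x≡0)
  ... | inj₂ (inj₁ x≡½) = h x≡½
  ... | inj₂ (inj₂ x≡1) = y≢1 (trans (fixed inv h) x≡1)

  module _ {y : Edge n → ℚ} (forest : Forest r y) (inv : Inv y) where

    frac⇒paired : ∀ {e} → Frac y e → ∃ λ g → (e , g) ∈ P ⊎ (g , e) ∈ P
    frac⇒paired {e} f with x e ℚ.≟ ½
    ... | yes h = ∈-flatten⁻ P (half⇒paired h)
    ... | no ¬h = ⊥-elim (fixed⇒¬frac inv ¬h f)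

    record Mate (e : Edge n) : Set where
      field
        sum-1 : y e + y (σ e) ≡ 1ℚ
        back  : σ (σ e) ≡ e
        apart : σ e ≢ e
    open Mate

    mate-of : ∀ {e} → Frac y e → Mate e
    mate-of {e} f with frac⇒paired f
    ... | g , inj₁ eg = record
      { sum-1 = trans (cong (λ z → y e + y z) σe) (pairs inv eg)
      ; back  = trans (cong σ σe) (mateʳ (edges n) unique eg)
      ; apart = λ eq → pair-≢ unique eg (trans (sym eq) σe) }
      where
      σe : σ e ≡ g
      σe = mateˡ (edges n) unique eg
    ... | g , inj₂ ge = record
      { sum-1 = trans (cong (λ z → y e + y z) σe) (trans (ℚ.+-comm (y e) (y g)) (pairs inv ge))
      ; back  = trans (cong σ σe) (mateˡ (edges n) unique ge)
      ; apart = λ eq → pair-≢ unique ge (trans (sym σe) eq) }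
      where
      σe : σ e ≡ g
      σe = mateʳ (edges n) unique ge

    complement : ∀ {p q} → p + q ≡ 1ℚ → p ≡ 1ℚ - q
    complement {p} {q} eq = trans (solve 2 (λ p q → p := p :+ q :- q) refl p q) (cong (_- q) eq)

    σ-frac : ∀ {e} → Frac y e → Frac y (σ e)
    σ-frac {e} f@(y≢0 , y≢1) =
      (λ eq → y≢1 (trans (complement (sum-1 (mate-of f))) (cong (λ z → 1ℚ - z) eq))) ,
      (λ eq → y≢0 (trans (complement (sum-1 (mate-of f))) (cong (λ z → 1ℚ - z) eq)))

    -- Equality of coefficients in every tight constraint is what the telescoping sum along a cycle
    -- consumes.
    Together : Edge n → Edge n → Set
    Together u v = All (λ c → slack (allEdges n) y c ≡ 0ℚ → proj₁ c u ≡ proj₁ c v) (constraints r)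

    twins-together : ∀ {u} (fu : Frac y u) (T : Twin r forest fu) → Together (Twin.twin T) u
    twins-together {u} fu T = all-constraints r
      (λ S S∈ (Sr , mem) t → cong ind (All.lookup together S∈
        (tightSet Sr mem (slack-zero r (trans (sym (slack-set r y S)) t)))))
      (λ _ → cong ind tree)
      (λ _ → cong (λ b → - 1ℚ * ind b) tree)
      (λ _ → cong ind rooted)
      (λ _ → cong (λ b → - 1ℚ * ind b) rooted)
      -- A tight bound makes `y e` integral, so `e` is neither of the two fractional edges and both
      -- coefficients are 0.
      (λ e t → same {e} (inj₂ (sym (slack-zero r {p = y e} (trans (sym (slack-upper r y e 1ℚ)) t)))))
      (λ e t → cong (- 1ℚ *_) (same {e} (inj₁ (trans (sym (slack-lower r y e)) t))))
      where
      open Twin T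
      tree : inside (others r) twin ≡ inside (others r) u
      tree = Bool.not-injective (trans (sym (incident-others r twin)) (trans rooted (incident-others r u)))
      same : ∀ {e} → y e ≡ 0ℚ ⊎ 1ℚ ≡ y e → basis (edges n) e twin ≡ basis (edges n) e u
      same {e} whole = trans (basis-≢ (edges n) (off frac)) (sym (basis-≢ (edges n) (off fu)))
        where
        off : ∀ {v} → Frac y v → v ≢ e
        off (y≢0 , y≢1) refl = Sum.[ y≢0 , (λ h → y≢1 (sym h)) ]′ whole

    partner : ∀ {u} → Frac y u → ∃ λ v → v ≢ u × Frac y v × Together v u
    partner fu = Twin.twin T , Twin.twin≢u T , Twin.frac T , twins-together fu T
      where T = twin-of r forest fu

    σ-back : ∀ {e} → Frac y e → σ (σ e) ≡ e
    σ-back f = back (mate-of f)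

    σ-apart : ∀ {e} → Frac y e → σ e ≢ e
    σ-apart f = apart (mate-of f)

    together-refl : ∀ {e} → Frac y e → Together e e
    together-refl _ = All.tabulate (λ _ _ → refl)

    together-trans : ∀ {e f g} → Together e f → Together f g → Together e g
    together-trans R S = All.zipWith (λ (p , q) t → trans (p t) (q t)) (R , S)

    open AlternatingCycles (edges n) y σ Together σ-frac σ-back σ-apart together-refl together-trans partner

    module _ (C : Cycle) where
      open Cycle C

      circulation : Edge n → ℚ
      circulation = flow vertices

      circulation-start : circulation start ≡ 1ℚ
      circulation-start = flow-start path simple

      keeps-tight : ∀ {c} → c ∈ constraints r → slack (allEdges n) y c ≡ 0ℚ →
                    dot (allEdges n) (proj₁ c) circulation ≡ 0ℚ
      keeps-tight {c} c∈ t = begin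
        dot (allEdges n) (proj₁ c) circulation
          ≡⟨ dot-flow (proj₁ c) (λ R → All.lookup R c∈ t) path ⟩
        proj₁ c start - proj₁ c (σ end)
          ≡⟨ cong (λ z → proj₁ c start - z) (All.lookup closed c∈ t) ⟩
        proj₁ c start - proj₁ c start
          ≡⟨ ℚ.+-inverseʳ (proj₁ c start) ⟩
        0ℚ ∎

      keeps-pairs : ∀ k {p q} → (p , q) ∈ P →
        move (allEdges n) y k circulation p + move (allEdges n) y k circulation q ≡ 1ℚ
      keeps-pairs k {p} {q} pq = begin
        y p + k * circulation p + (y q + k * circulation q)
          ≡⟨ regroup (y p) (y q) (circulation p) (circulation q) k ⟩
        y p + y q + k * (circulation p + circulation q)
          ≡⟨ cong₂ (λ s t → s + k * t) (pairs inv pq)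
               (flow-pair (mateˡ (edges n) unique pq) (mateʳ (edges n) unique pq) path) ⟩
        1ℚ + k * 0ℚ
          ≡⟨ solve 1 (λ k → con 1ℚ :+ k :* con 0ℚ := con 1ℚ) refl k ⟩
        1ℚ ∎
        where
        regroup : ∀ a b c e k → a + k * c + (b + k * e) ≡ a + b + k * (c + e)
        regroup = solve 5 (λ a b c e k → a :+ k :* c :+ (b :+ k :* e) := a :+ b :+ k :* (c :+ e)) refl

      keeps-fixed : ∀ k {e} → x e ≢ ½ → move (allEdges n) y k circulation e ≡ x e
      keeps-fixed k {e} h = begin
        y e + k * circulation e
          ≡⟨ cong₂ (λ s t → s + k * t) (fixed inv h) (flow-off (fixed⇒¬frac inv h) path) ⟩
        x e + k * 0ℚ
          ≡⟨ solve 2 (λ q k → q :+ k :* con 0ℚ := q) refl (x e) k ⟩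
        x e ∎

      rate-upper : rate (allEdges n) circulation (upperC r start 1ℚ) ≡ - 1ℚ
      rate-upper = cong -_ (trans (dot-basisˡ (edges n) start circulation) circulation-start)

      rate-lower : rate (allEdges n) circulation (opposite r (upperC r start 0ℚ)) ≡ 1ℚ
      rate-lower = trans
        (cong -_ (trans (dot-*ˡ (allEdges n) (- 1ℚ) (basis (edges n) start) circulation)
          (cong (- 1ℚ *_) (trans (dot-basisˡ (edges n) start circulation) circulation-start)))) refl

      circulation-direction : Direction (allEdges n) (constraints r) Inv y
      circulation-direction = record
        { dir = circulation
        ; keeps = All.tabulate (λ c∈ t → cong -_ (keeps-tight c∈ t))
        ; invariant = λ k → record { pairs = keeps-pairs k ; fixed = keeps-fixed k }
        -- The circulation is 1 at its start: moving along it uses up the upper bound there, moving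
        -- against it the lower bound.
        ; falls = lose (upper∈ r start) (subst (_<ℚ 0ℚ) (sym rate-upper) (ℚ.negative⁻¹ (- 1ℚ)))
        ; rises = lose (lower∈ r start) (subst (0ℚ <ℚ_) (sym rate-lower) (ℚ.positive⁻¹ 1ℚ))
        }

    direction : ∀ {u} → Frac y u → Direction (allEdges n) (constraints r) Inv y
    direction fu = circulation-direction (cycle-from fu)

-- Integral points are 1-trees

not-2 : ∀ a b → ind a + ind b ≡ 1ℚ → a xor b ≡ true
not-2 true  true  ()
not-2 true  false _ = refl
not-2 false true  _ = refl
not-2 false false ()

nat-length-filterB : ∀ {A : Set} (p : A → Bool) L → nat (length (filterB p L)) ≡ sum L (λ a → ind (p a))
nat-length-filterB p [] = refl
nat-length-filterB p (a ∷ L) with p a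
... | true  = cong (1ℚ +_) (nat-length-filterB p L)
... | false = trans (nat-length-filterB p L) (sym (ℚ.+-identityˡ _))

1≰0 : ¬ 1ℚ ≤ℚ 0ℚ
1≰0 h = ℚ.<-irrefl refl (ℚ.<-≤-trans (ℚ.positive⁻¹ 1ℚ) h)

xor-split : ∀ a b → a xor b ≡ true → (a ≡ true × b ≡ false) ⊎ (a ≡ false × b ≡ true)
xor-split true  false _ = inj₁ (refl , refl)
xor-split false true  _ = inj₂ (refl , refl)

size-single : ∀ {n} (v : Fin n) → size (single v) ≡ 1ℚ
size-single v = trans (sum-fin-at _ v (λ w w≢v → cong ind (single-≢ w≢v))) (cong ind (single-refl v))

size-add : ∀ {n} (S : VSet n) v → S v ≡ false → size (S ∪ single v) ≡ size S + 1ℚ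
size-add {n} S v Sv = trans (trans (sum-cong (allFin n) add) (sum-+ (allFin n) _ _))
                            (cong (size S +_) (size-single v))
  where
  add : ∀ w → ind (S w ∨ single v w) ≡ ind (S w) + ind (single v w)
  add w with w Fin.≟ v
  ... | yes refl rewrite Sv = refl
  ... | no _ with S w
  ... | true  = refl
  ... | false = refl

module _ {n : ℕ} (r : Fin n) {y : Edge n → ℚ} (forest : Forest r y) (F : ESet n)
         (integral : ∀ e → ind (F e) ≡ y e) where
  open Forest forest

  G : Edge n → Set
  G = restrict r F

  in-F : ∀ {e} → F e ≡ true → y e ≡ 1ℚ
  in-F {e} Fe = trans (sym (integral e)) (cong ind Fe)

  root-degree : degIn r F ≡ 2
  root-degree = nat-injective (begin
    nat (degIn r F)
      ≡⟨ nat-length-filterB (λ e → F e ∧ incident r e) (allEdges n) ⟩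
    sum (allEdges n) (λ e → ind (F e ∧ incident r e))
      ≡⟨ sum-cong (allEdges n) (λ e → trans (bool (F e) (incident r e)) (cong (ind (incident r e) *_) (integral e))) ⟩
    inner (incident r) y
      ≡⟨ root ⟩
    2ℚ ∎)
    where
    bool : ∀ a b → ind (a ∧ b) ≡ ind b * ind a
    bool true  true  = refl
    bool true  false = refl
    bool false true  = refl
    bool false false = refl

  -- Were no tree edge to cross, S and its complement T in V - r would carry all the weight, at most
  -- (|S| - 1) + (|T| - 1), which is one less than `full` demands.
  no-cut : ∀ S → S r ≡ false → (∃ λ v → S v ≡ true) → (∃ λ v → v ≢ r × S v ≡ false) →
           (∀ e → F e ≡ true → incident r e ≡ false → crosses S e ≡ false) → ⊥
  no-cut S Sr S-mem (w , w≢r , Sw) closed = 1≰0 (≤-by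
    (+-≥0 (+-≥0 (diff≥0 (sparse S Sr S-mem)) (diff≥0 (sparse T Tr (w , ∧-true (≢⇒others r w≢r) (cong not Sw)))))
          (inner≥0 (inside (S ∩ T)) y≥0))
    (algebra (mass y S) (mass y T) (mass y (S ∩ T)) (size S) (size T)
      (begin
        mass y S + mass y T + 0ℚ + 1ℚ                        ≡⟨ cong (λ z → mass y S + mass y T + z + 1ℚ) no-between ⟨
        mass y S + mass y T + inner (between S T) y + 1ℚ     ≡⟨ cong (_+ 1ℚ) (mass-supermodular y S T) ⟨
        mass y (S ∪ T) + mass y (S ∩ T) + 1ℚ
          ≡⟨ solve 2 (λ a b → a :+ b :+ con 1ℚ := a :+ con 1ℚ :+ b) refl (mass y (S ∪ T)) (mass y (S ∩ T)) ⟩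
        mass y (S ∪ T) + 1ℚ + mass y (S ∩ T)                 ≡⟨ cong (λ z → z + 1ℚ + mass y (S ∩ T)) (mass-cong y union) ⟩
        mass y V + 1ℚ + mass y (S ∩ T)                       ≡⟨ cong (_+ mass y (S ∩ T)) full ⟩
        size V + mass y (S ∩ T)                              ≡⟨ cong (_+ mass y (S ∩ T)) sizes ⟩
        size S + size T + mass y (S ∩ T)                     ∎)))
    where
    V T : VSet n
    V = others r
    T v = V v ∧ not (S v)
    Tr : T r ≡ false
    Tr = cong (_∧ not (S r)) (others-r r)
    bool-∪ : ∀ {s v} → (s ≡ true → v ≡ true) → s ∨ (v ∧ not s) ≡ v
    bool-∪ {true}          h = sym (h refl)
    bool-∪ {false} {true}  h = refl
    bool-∪ {false} {false} h = refl
    union : ∀ v → (S ∪ T) v ≡ V v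
    union v = bool-∪ (others-⊇ r {S} Sr v)
    bool-∩ : ∀ s v → s ∧ (v ∧ not s) ≡ false
    bool-∩ true  true  = refl
    bool-∩ true  false = refl
    bool-∩ false v     = refl
    sizes : size V ≡ size S + size T
    sizes = begin
      size V                       ≡⟨ size-cong union ⟨
      size (S ∪ T)                 ≡⟨ ℚ.+-identityʳ _ ⟨
      size (S ∪ T) + 0ℚ            ≡⟨ cong (size (S ∪ T) +_) (trans (sum-cong (allFin n)
                                        (λ v → cong ind (bool-∩ (S v) (V v)))) (sum-0 (allFin n))) ⟨
      size (S ∪ T) + size (S ∩ T)  ≡⟨ size-modular S T ⟩
      size S + size T              ∎
    bool-× : ∀ a b c d → ((a ∨ (c ∧ not a)) ∧ (b ∨ (d ∧ not b))) ∧ not (a ∧ b ∨ (c ∧ not a) ∧ (d ∧ not b)) ≡ true →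
             a xor b ≡ true
    bool-× true  true  c     d     h = h
    bool-× true  false c     d     h = refl
    bool-× false true  c     d     h = refl
    bool-× false false true  true  h = h
    bool-× false false true  false h = h
    bool-× false false false d     h = h
    no-between : inner (between S T) y ≡ 0ℚ
    no-between = trans (sum-cong (allEdges n) (λ e → term e (between S T e) refl (F e) refl)) (sum-0 (allEdges n))
      where
      term : ∀ e b → between S T e ≡ b → ∀ f → F e ≡ f → ind b * y e ≡ 0ℚ
      term e false _  f     _  = ℚ.*-zeroˡ (y e)
      term e true  be false Fe = cong (1ℚ *_) (trans (sym (integral e)) (cong ind Fe))
      term e true  be true  Fe = ⊥-elim (true≢false
        (bool-× (S (lo e)) (S (hi e)) (V (lo e)) (V (hi e)) be)
        (closed e Fe (inside⇒¬incident r {V} {e} (others-r r)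
          (trans (sym (cong₂ _∧_ (union (lo e)) (union (hi e)))) (∧-trueˡ be)))))
    algebra : ∀ s t m a b → s + t + 0ℚ + 1ℚ ≡ a + b + m →
              1ℚ + (a - (s + 1ℚ) + (b - (t + 1ℚ)) + m) ≡ 0ℚ
    algebra s t m a b eq = begin
      1ℚ + (a - (s + 1ℚ) + (b - (t + 1ℚ)) + m)
        ≡⟨ solve 5 (λ s t m a b → con 1ℚ :+ (a :- (s :+ con 1ℚ) :+ (b :- (t :+ con 1ℚ)) :+ m)
                      := a :+ b :+ m :- (s :+ t :+ con 0ℚ :+ con 1ℚ)) refl s t m a b ⟩
      a + b + m - (s + t + 0ℚ + 1ℚ)
        ≡⟨ cong (λ z → a + b + m - z) eq ⟩
      a + b + m - (a + b + m)
        ≡⟨ ℚ.+-inverseʳ (a + b + m) ⟩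
      0ℚ ∎

  endpoint-≢ : ∀ e → incident r e ≡ false → lo e ≢ r × hi e ≢ r
  endpoint-≢ e inc =
    (λ { refl → true≢false (trans (cong₂ _xor_ (single-refl (lo e)) (single-≢ (λ eq → lo≢hi e (sym eq)))) refl) inc }) ,
    (λ { refl → true≢false (trans (cong₂ _xor_ (single-≢ (lo≢hi e)) (single-refl (hi e))) refl) inc })

  -- Connectedness

  module _ {v : Fin n} (v≢r : v ≢ r) where

    missing : VSet n → ℕ
    missing S = length (filterB (λ w → not (S w)) (allFin n))

    missing-add : ∀ S w → S w ≡ false → missing (S ∪ single w) <ℕ missing S
    missing-add S w Sw = filterB-length-< (λ w → not (S w)) (λ u → not ((S ∪ single w) u))
      (All.tabulate (λ {u} _ h → cong not (∨-trueˡ (Bool.not-injective h))))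
      (lose (∈-allFin w) (cong not Sw , cong not (∨-trueʳ {S w} (single-refl w))))

    exit? : ∀ S → Dec (∃ λ e → G e × crosses S e ≡ true)
    exit? S with Any.any? (λ e → ((F e Bool.≟ true) ×-dec (incident r e Bool.≟ false)) ×-dec (crosses S e Bool.≟ true)) (allEdges n)
    ... | yes found = yes (Any.satisfied found)
    ... | no none   = no (λ (e , h) → none (lose (Enumeration.complete (edges n) e) h))

    -- S holds vertices known to reach `v`. While `u` is outside, `no-cut` yields a tree edge
    -- leaving S, and its outer end joins S.
    explore : ∀ k S → missing S <ℕ k → S v ≡ true → S r ≡ false →
              (∀ w → S w ≡ true → Reach G w v) → ∀ u → u ≢ r → Reach G u v
    explore (suc k) S bound Sv Sr reach u u≢r = go (exit? S) (S u) refl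
      where
      add : ∀ w → S w ≡ false → w ≢ r → Reach G w v → Reach G u v
      add w Sw w≢r Rw = explore k (S ∪ single w)
        (ℕ.≤-trans (missing-add S w Sw) (ℕ.≤-pred bound))
        (∨-trueˡ Sv) (cong₂ _∨_ Sr (single-≢ (λ eq → w≢r (sym eq)))) reach′ u u≢r
        where
        reach′ : ∀ t → S t ∨ single w t ≡ true → Reach G t v
        reach′ t h with S t in St
        ... | true  = reach t St
        ... | false = subst (λ z → Reach G z v) (sym (single-≡ h)) Rw
      go : Dec (∃ λ e → G e × crosses S e ≡ true) → ∀ b → S u ≡ b → Reach G u v
      go _ true Su = reach u Su
      go (no none) false Su = ⊥-elim (no-cut S Sr (v , Sv) (u , u≢r , Su)
        (λ e Fe inc → ¬true⇒false (λ h → none (e , (Fe , inc) , h))))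
      go (yes (e , Ge , cr)) false Su with xor-split (S (lo e)) (S (hi e)) cr
      ... | inj₁ (Slo , Shi) = add (hi e) Shi (proj₂ (endpoint-≢ e (proj₂ Ge))) (bwd e Ge (reach (lo e) Slo))
      ... | inj₂ (Slo , Shi) = add (lo e) Slo (proj₁ (endpoint-≢ e (proj₂ Ge))) (fwd e Ge (reach (hi e) Shi))

    connected : ∀ u → u ≢ r → Reach G u v
    connected = explore _ (single v) ℕ.≤-refl (single-refl v) (single-≢ (λ eq → v≢r (sym eq)))
      (λ w h → subst (λ z → Reach G z v) (sym (single-≡ h)) here)

  -- Acyclicity

  module _ {e₀ : Edge n} (Ge₀ : G e₀) where

    -- The weights with `e₀`, of weight 1, deleted. Another path between its ends would yield a
    -- vertex set S containing both ends with weight at least |S| - 1 without `e₀`, and restoring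
    -- `e₀` would violate `sparse`.
    y⁻ : Edge n → ℚ
    y⁻ f = y f + - 1ℚ * basis (edges n) e₀ f

    y⁻≥0 : ∀ f → 0ℚ ≤ℚ y⁻ f
    y⁻≥0 f with edge-≟ f e₀
    ... | yes refl = ℚ.≤-reflexive (sym (cong (_+ - 1ℚ * 1ℚ) (in-F (proj₁ Ge₀))))
    ... | no _     = subst (0ℚ ≤ℚ_) (solve 1 (λ q → q := q :+ con (- 1ℚ) :* con 0ℚ) refl (y f)) (y≥0 f)

    y⁻-1 : ∀ {f} → G f → f ≢ e₀ → y⁻ f ≡ 1ℚ
    y⁻-1 {f} Gf f≢e₀ = cong₂ (λ p q → p + - 1ℚ * q) (in-F (proj₁ Gf)) (basis-≢ (edges n) f≢e₀)

    mass-y⁻ : ∀ S → inside S e₀ ≡ true → mass y⁻ S ≡ mass y S - 1ℚ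
    mass-y⁻ S Se₀ = begin
      mass y⁻ S
        ≡⟨ dot-+ʳ (allEdges n) a y _ ⟩
      mass y S + dot (allEdges n) a (λ f → - 1ℚ * basis (edges n) e₀ f)
        ≡⟨ cong (mass y S +_) (trans (dot-*ʳ (allEdges n) a (- 1ℚ) (basis (edges n) e₀))
             (cong (- 1ℚ *_) (trans (dot-basisʳ (edges n) a e₀) (cong ind Se₀)))) ⟩
      mass y S - 1ℚ ∎
      where
      a : Edge n → ℚ
      a e = ind (inside S e)

    -- Edges inside S remain inside, `f` is a further one, and all remaining weights are
    -- nonnegative.
    mass-add : ∀ S w f → inside S f ≡ false → inside (S ∪ single w) f ≡ true →
               mass y⁻ S + y⁻ f ≤ℚ mass y⁻ (S ∪ single w)
    mass-add S w f Sf S′f = ≤-by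
      (dot-≥0 (allEdges n) {a = λ g → ind (inside S′ g) + - 1ℚ * (ind (inside S g) + basis (edges n) f g)} gain y⁻≥0)
      (begin
        mass y⁻ S + y⁻ f + dot (allEdges n) (λ g → ind (inside S′ g) + - 1ℚ * (ind (inside S g) + basis (edges n) f g)) y⁻
          ≡⟨ cong (mass y⁻ S + y⁻ f +_) expand ⟩
        mass y⁻ S + y⁻ f + (mass y⁻ S′ + - 1ℚ * (mass y⁻ S + y⁻ f))
          ≡⟨ solve 3 (λ a b c → a :+ b :+ (c :+ con (- 1ℚ) :* (a :+ b)) := c) refl (mass y⁻ S) (y⁻ f) (mass y⁻ S′) ⟩
        mass y⁻ S′ ∎)
      where
      S′ : VSet n
      S′ = S ∪ single w
      expand : dot (allEdges n) (λ g → ind (inside S′ g) + - 1ℚ * (ind (inside S g) + basis (edges n) f g)) y⁻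
               ≡ mass y⁻ S′ + - 1ℚ * (mass y⁻ S + y⁻ f)
      expand = begin
        dot (allEdges n) (λ g → ind (inside S′ g) + - 1ℚ * (ind (inside S g) + basis (edges n) f g)) y⁻
          ≡⟨ dot-+ˡ (allEdges n) (λ g → ind (inside S′ g)) (λ g → - 1ℚ * (ind (inside S g) + basis (edges n) f g)) y⁻ ⟩
        mass y⁻ S′ + dot (allEdges n) (λ g → - 1ℚ * (ind (inside S g) + basis (edges n) f g)) y⁻
          ≡⟨ cong (mass y⁻ S′ +_) (trans
               (dot-*ˡ (allEdges n) (- 1ℚ) (λ g → ind (inside S g) + basis (edges n) f g) y⁻)
               (cong (- 1ℚ *_) (trans
                 (dot-+ˡ (allEdges n) (λ g → ind (inside S g)) (basis (edges n) f) y⁻)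
                 (cong (mass y⁻ S +_) (dot-basisˡ (edges n) f y⁻))))) ⟩
        mass y⁻ S′ + - 1ℚ * (mass y⁻ S + y⁻ f) ∎
      bool : ∀ a b → (a ≡ true → b ≡ true) → 0ℚ ≤ℚ ind b + - 1ℚ * (ind a + 0ℚ)
      bool true  true  h = ℚ.≤-refl
      bool true  false h with () ← h refl
      bool false true  h = 0≤1
      bool false false h = ℚ.≤-refl
      gain : ∀ g → 0ℚ ≤ℚ ind (inside S′ g) + - 1ℚ * (ind (inside S g) + basis (edges n) f g)
      gain g with edge-≟ g f
      ... | yes refl = ℚ.≤-reflexive (sym (cong₂ (λ p q → ind p + - 1ℚ * (ind q + 1ℚ)) S′f Sf))
      ... | no _     = bool (inside S g) (inside S′ g) (inside-⊆ {S = S} {T = S′} (λ v → ∨-trueˡ) g)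

    -- The vertices of a path, with connectedness replaced by its numerical trace `dense`: weight at
    -- least |S| - 1 without `e₀`.
    record Connector (a b : Fin n) : Set where
      field
        set    : VSet n
        avoids : set r ≡ false
        from   : set a ≡ true
        to     : set b ≡ true
        dense  : size set ≤ℚ mass y⁻ set + 1ℚ

    -- The last two hypotheses say that `f` joins `a` to `b` without fixing its orientation, so both
    -- directions of travel share the argument. A vertex met before changes nothing; a new one
    -- brings at least the weight 1 of `f`.
    attach : ∀ {a b c} f → G f → f ≢ e₀ → a ≢ r → Connector b c →
             (∀ S → S b ≡ true → S a ≡ true → inside S f ≡ true) →
             (∀ S → S a ≡ false → inside S f ≡ false) → Connector a c
    attach {a} {b} {c} f Gf f≢e₀ a≢r K on off with Connector.set K a in Sa
    ... | true  = record { set = set ; avoids = avoids ; from = Sa ; to = to ; dense = dense }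
      where open Connector K
    ... | false = record
      { set = S ∪ single a
      ; avoids = cong₂ _∨_ avoids (single-≢ (λ eq → a≢r (sym eq)))
      ; from = ∨-trueʳ {S a} (single-refl a)
      ; to = ∨-trueˡ to
      ; dense = subst₂ _≤ℚ_ (sym (size-add S a Sa)) refl (ℚ.+-monoˡ-≤ 1ℚ (ℚ.≤-trans dense
          (subst (λ q → mass y⁻ S + q ≤ℚ mass y⁻ (S ∪ single a)) (y⁻-1 Gf f≢e₀)
            (mass-add S a f (off S Sa) (on (S ∪ single a) (∨-trueˡ from) (∨-trueʳ {S a} (single-refl a)))))))
      }
      where
      open Connector K
      S : VSet n
      S = set

    connector : ∀ {a b} → a ≢ r → Reach (λ f → G f × f ≢ e₀) a b → Connector a b
    connector {a} a≢r here = record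
      { set = single a ; avoids = single-≢ (λ eq → a≢r (sym eq))
      ; from = single-refl a ; to = single-refl a
      ; dense = subst (_≤ℚ mass y⁻ (single a) + 1ℚ) (sym (size-single a))
          (≤-by (inner≥0 (inside (single a)) y⁻≥0) (ℚ.+-comm 1ℚ (mass y⁻ (single a)))) }
    connector a≢r (fwd f (Gf , f≢e₀) p) = attach f Gf f≢e₀ a≢r
      (connector (proj₂ (endpoint-≢ f (proj₂ Gf))) p)
      (λ S Sb Sa → ∧-true Sa Sb) (λ S Sa → cong (_∧ S (hi f)) Sa)
    connector a≢r (bwd f (Gf , f≢e₀) p) = attach f Gf f≢e₀ a≢r
      (connector (proj₁ (endpoint-≢ f (proj₂ Gf))) p)
      (λ S Sb Sa → ∧-true Sb Sa) (λ S Sa → trans (cong (S (lo f) ∧_) Sa) (Bool.∧-zeroʳ (S (lo f))))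

    acyclic : ¬ Reach (λ f → G f × f ≢ e₀) (lo e₀) (hi e₀)
    acyclic p = 1≰0 (≤-by (+-≥0 (diff≥0 (sparse set avoids (lo e₀ , from))) (diff≥0 dense)) (begin
      1ℚ + (size set - (mass y set + 1ℚ) + (mass y⁻ set + 1ℚ - size set))
        ≡⟨ cong (λ q → 1ℚ + (size set - (mass y set + 1ℚ) + (q + 1ℚ - size set)))
             (mass-y⁻ set (∧-true from to)) ⟩
      1ℚ + (size set - (mass y set + 1ℚ) + (mass y set - 1ℚ + 1ℚ - size set))
        ≡⟨ solve 2 (λ s m → con 1ℚ :+ (s :- (m :+ con 1ℚ) :+ (m :- con 1ℚ :+ con 1ℚ :- s)) := con 0ℚ)
             refl (size set) (mass y set) ⟩
      0ℚ ∎))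
      where open Connector (connector (proj₁ (endpoint-≢ e₀ (proj₂ Ge₀))) p)

  oneTree : OneTree r F
  oneTree = root-degree , (λ e → proj₂) , (λ u v u≢r v≢r → connected v≢r u u≢r) , (λ e Ge → acyclic Ge)

-- Decomposition of x into 1-trees

module _ {n : ℕ} (r : Fin n) {x : Edge n → ℚ} (half : HalfInteger x)
         {P : List (Edge n × Edge n)} (part : PairPartition x P) where

  Vertex : (Edge n → ℚ) → Set
  Vertex y = Forest r y × Inv r half part y × (∀ e → ¬ Frac y e)

  vertex-or-direction : ∀ {y} → Feas r y → Inv r half part y →
                        Vertex y ⊎ Direction (allEdges n) (constraints r) (Inv r half part) y
  vertex-or-direction {y} feas inv with Any.any? (frac? y) (allEdges n)
  ... | yes found = inj₂ (direction r half part (feasible⇒forest r feas) inv (proj₂ (Any.satisfied found)))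
  ... | no none   = inj₁ (feasible⇒forest r feas , inv ,
                          λ e f → none (lose (Enumeration.complete (edges n) e) f))

  round : ∀ {y} → Vertex y →
          ∃ λ F → (OneTree r F × OnePerPair P F) × (∀ e → χ F e ≡ y e)
  round {y} (forest , inv , ¬frac) = F , (oneTree r forest F integral , exactly-one) ,
    (λ e → trans (χ-ind (F e)) (integral e))
    where
    F : ESet n
    F e = ⌊ y e ℚ.≟ 1ℚ ⌋
    integral : ∀ e → ind (F e) ≡ y e
    integral e with y e ℚ.≟ 1ℚ
    ... | yes y≡1 = sym y≡1
    ... | no y≢1  = sym (Sum.[ (λ y≡0 → y≡0) , (λ y≡1 → ⊥-elim (y≢1 y≡1)) ]′ (¬frac⇒int y e (¬frac e)))
    exactly-one : OnePerPair P F
    exactly-one {p} {q} pq = not-2 (F p) (F q)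
      (trans (cong₂ _+_ (integral p) (integral q)) (Inv.pairs inv pq))
    χ-ind : ∀ b → (if b then 1ℚ else 0ℚ) ≡ ind b
    χ-ind true  = refl
    χ-ind false = refl

theorem6 : (n : ℕ) → 3 ≤ n → (r : Fin n) → (x : Edge n → ℚ) →
    InSubtour n x → HalfInteger x →
    (P : List (Edge n × Edge n)) → PairPartition x P →
    InConvexHull (λ F → OneTree r F × OnePerPair P F) x
theorem6 n _ r x sub half P part = hull⇒convexHull (round r half part)
  (feasible⇒hull (allEdges n) (constraints r) (inv-resp r half part) (vertex-or-direction r half part)
    _ ℕ.≤-refl (forest⇒feasible r (subtour⇒forest r sub)) (inv-x r half part))
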